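{- Let $V$ be a finite set (case $q=1$) or a finite-dimensional $\mathbb{F}_q$-vector space (case $q\ge 2$ a prime power) with $n=\operatorname{rk}V\ge1$. Let $H\in{V\brack n-1}$ be a hyperplane and $0\le k\le n-1$. Then $$\Psi:\mathbb{R}^{{H\brack k}}\to\mathbb{R}^{{V\brack k}},\qquad \Psi(f):K\mapsto\begin{cases}f(K)&\text{if }K\le H,\\0&\text{if }K\nleq H\end{cases}$$ is an injective $\mathbb{R}$-linear map with image $$\operatorname{im}(\Psi)=\Big\{g\in\mathbb{R}^{{V\brack k}}\ \Big|\ \operatorname{supp}g\subseteq{H\brack k}\Big\},$$ and for all $f:{H\brack k}\to\mathbb{R}$ $$\deg_V(\Psi(f))=\min(\deg_H(f)+1,\;k).$$ Moreover, for all $e\in\{\max(\deg_H(f),0)+1,\ldots,\min(k,n-k)\}$ and all $E\in{V\brack e}$, $$\operatorname{wt}^{(e)}_{\Psi(f)}(E)=\begin{cases}\displaystyle\frac{1}{[k-e+1]_q}\sum_{E'\in{E\brack e-1}}\operatorname{wt}^{(e-1)}_f(E')&\text{if }E\le H,\\[4mm]\displaystyle-\frac{[k-e]_q}{q^{k-e}\,[k-e+1]_q}\operatorname{wt}^{(e-1)}_f(E\cap H)&\text{if }E\nleq H.\end{cases}$$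
   Context: For $q=1$, "subspaces" of $V$ are subsets and $\operatorname{rk}U=\#U$; for $q\ge2$ they are $\mathbb{F}_q$-linear subspaces and $\operatorname{rk}U=\dim U$. $U\le W$ means inclusion. $[m]_q=1+q+\cdots+q^{m-1}$ (so $[m]_1=m$ and $[0]_q=0$). For any ambient space $W$ of rank $m$ (here $W=V$ with $m=n$, or $W=H$ with $m=n-1$), ${W\brack k}$ is the set of all subspaces of $W$ of rank $k$. For a subspace $U$ of $W$, $\boldsymbol{x}_U^{(k)}:{W\brack k}\to\mathbb{R}$ is the characteristic function of $\{K\in{W\brack k}\mid U\le K\}$. For $0\le k\le m$ and $i\in\{0,\ldots,\min(k,m-k)\}$, let $\bar V_i^{(k)}(W)\subseteq\mathbb{R}^{{W\brack k}}$ be the real span of $\{\boldsymbol{x}_I^{(k)}\mid I\in{W\brack i}\}$; this set is a basis of $\bar V_i^{(k)}(W)$ (a known fact), and these spaces form an increasing chain ending in $\mathbb{R}^{{W\brack k}}$ for $i=\min(k,m-k)$. For $f\in\bar V_i^{(k)}(W)$, the $i$-weight distribution $\operatorname{wt}_f^{(i)}:{W\brack i}\to\mathbb{R}$ is the unique function with $f=\sum_{I\in{W\brack i}}\operatorname{wt}_f^{(i)}(I)\,\boldsymbol{x}_I^{(k)}$. The degree $\deg_W(f)$ of a non-zero $f:{W\brack k}\to\mathbb{R}$ is the smallest $t\in\{0,\ldots,\min(k,m-k)\}$ with $f\in\bar V_t^{(k)}(W)$; $\deg_W(\boldsymbol 0)=-\infty$, with $-\infty+1=-\infty$. -}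

module Defs where

open import Algebra.Bundles using (CommutativeRing)
open import Algebra.Module.Bundles using (Module)
open import Algebra.Module.Bundles.Raw using (RawLeftModule)
import Algebra.Module.Morphism.Structures as ModuleMorphism
import Algebra.Properties.CommutativeMonoid.Sum as Summation
import Algebra.Properties.Monoid.Mult as Multiple
open import Data.Fin.Base using (Fin; zero; suc; combine; finToFun; funToFin)
import Data.Fin.Properties as Fin
open import Data.Fin.Subset using (Subset; inside; outside; _∈_; _⊆_; ∣_∣; ⊤)
open import Data.Fin.Subset.Properties using (_∈?_; _⊆?_; ⊆-trans)
open import Data.Irrelevant as Irrelevant using ([_])
open import Data.List.Base as List using (List; []; _∷_; _++_)
import Data.Maybe.Base as Maybe
open import Data.Nat.Base as ℕ using (ℕ; zero; suc; _⊓_; _∸_; _^_)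
import Data.Nat.Properties as ℕ
open import Data.Product using (∃; ∃-syntax; _×_; _,_)
open import Data.Refinement using (Refinement-syntax; _,_; value; proof; refine)
import Data.Unit.Base as Unit
open import Data.Vec.Base using ([]; _∷_)
open import Data.Vec.Functional using (Vector)
open import Data.Vec.Functional.Relation.Binary.Equality.Setoid using (≋-setoid)
open import Function.Base using (_∘_)
open import Function.Bundles using (Inverse)
open import Level using (0ℓ)
open import Relation.Binary.Bundles using (Setoid)
open import Relation.Binary.Definitions using (_Respects_)
open import Relation.Binary.PropositionalEquality as ≡ using (_≡_)
open import Relation.Binary.Structures using (IsDecTotalOrder)
open import Relation.Nullary using (¬_; Dec; yes; no)
open import Relation.Nullary.Construct.Add.Infimum using (_₋; ⊥₋) renaming ([_] to [_]₋)
open import Relation.Nullary.Decidable using (map′; _×-dec_; _→-dec_; dec⇒maybe)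

-- The inverse is a total operation; its value at 0# is left unspecified.
record Field : Set₁ where
  infix 8 _⁻¹
  field
    commutativeRing : CommutativeRing 0ℓ 0ℓ
  open CommutativeRing commutativeRing public
  field
    _⁻¹        : Carrier → Carrier
    *-inverseʳ : ∀ x → ¬ (x ≈ 0#) → x * x ⁻¹ ≈ 1#
    0≉1        : ¬ (0# ≈ 1#)

-- A Dedekind-complete ordered field.  The real numbers are the only such
-- structure up to isomorphism, so quantifying over this record is the axiomatic
-- way of working over ℝ, which the library does not provide.
record RealNumbers : Set₁ where
  infix 4 _≤_
  infixl 7 _/_
  field
    realField : Field
  open Field realField public
  field
    _≤_             : Carrier → Carrier → Set
    isDecTotalOrder : IsDecTotalOrder _≈_ _≤_
    +-monoˡ-≤       : ∀ z {x y} → x ≤ y → x + z ≤ y + z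
    *-nonNegative   : ∀ {x y} → 0# ≤ x → 0# ≤ y → 0# ≤ x * y

  UpperBound : (Carrier → Set) → Carrier → Set
  UpperBound P b = ∀ x → P x → x ≤ b

  field
    supremum : (P : Carrier → Set) → ∃ P → ∃ (UpperBound P) →
               ∃[ s ] UpperBound P s × (∀ b → UpperBound P b → s ≤ b)

  _/_ : Carrier → Carrier → Carrier
  x / y = x * y ⁻¹

  open Multiple +-monoid using () renaming (_×_ to _times_)

  fromℕ : ℕ → Carrier
  fromℕ m = m times 1#

  open Summation +-commutativeMonoid public using (sum)

record Finite (S : Setoid 0ℓ 0ℓ) : Set where
  open Setoid S
  field
    size        : ℕ
    enumeration : Inverse S (≡.setoid (Fin size))
  open Inverse enumeration public
    renaming (to to index; from to element; to-cong to index-cong)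

  infix 4 _≈?_
  _≈?_ : ∀ x y → Dec (x ≈ y)
  x ≈? y = map′
    (λ p → trans (sym (strictlyInverseʳ x)) (trans (from-cong p) (strictlyInverseʳ y)))
    index-cong
    (index x Fin.≟ index y)

  module _ {P : Carrier → Set} (resp : P Respects _≈_) (P? : ∀ x → Dec (P x)) where

    all? : Dec (∀ x → P x)
    all? = map′ (λ p x → resp (strictlyInverseʳ x) (p (index x))) (λ p → p ∘ element)
                (Fin.all? (P? ∘ element))

    any? : Dec (∃ P)
    any? = map′ (λ (i , p) → element i , p)
                (λ (x , p) → index x , resp (sym (strictlyInverseʳ x)) p)
                (Fin.any? (P? ∘ element))

vectors : ∀ {S} → Finite S → ∀ d → Finite (≋-setoid S d)
vectors {S} fin d = record
  { size        = size ^ d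
  ; enumeration = record
    { to        = to
    ; from      = from
    ; to-cong   = to-cong
    ; from-cong = λ { ≡.refl _ → refl }
    ; inverse   = (λ {i} eq → ≡.trans (to-cong eq) (to-from i))
                , (λ {v} eq j → trans (reflexive (≡.cong (λ i → from i j) eq)) (from-to v j))
    }
  }
  where
  open Setoid S
  open Finite fin using (size; index; element; index-cong; strictlyInverseˡ; strictlyInverseʳ)

  to : Vector Carrier d → Fin (size ^ d)
  to v = funToFin (index ∘ v)

  from : Fin (size ^ d) → Vector Carrier d
  from i j = element (finToFun i j)

  funToFin-cong : ∀ {m n} {f g : Fin m → Fin n} → (∀ j → f j ≡ g j) → funToFin f ≡ funToFin g
  funToFin-cong {zero}  eq = ≡.refl
  funToFin-cong {suc m} eq =
    ≡.cong₂ combine (eq zero) (funToFin-cong (eq ∘ suc))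

  to-cong : ∀ {u v} → (∀ j → u j ≈ v j) → to u ≡ to v
  to-cong eq = funToFin-cong (index-cong ∘ eq)

  to-from : ∀ i → to (from i) ≡ i
  to-from i = ≡.trans (funToFin-cong {d} (λ j → strictlyInverseˡ (finToFun i j)))
                      (Fin.funToFin-finToFin {d} {size} i)

  from-to : ∀ v j → from (to v) j ≈ v j
  from-to v j = trans (reflexive (≡.cong element (Fin.finToFun-funToFin (index ∘ v) j)))
                      (strictlyInverseʳ (v j))

record FiniteField : Set₁ where
  field
    field′ : Field
  open Field field′ public
  field
    finite : Finite setoid

  order : ℕ
  order = Finite.size finite

-- Subsets of the vector space are handled through the enumeration of its vectors.
module LinearAlgebra (F : FiniteField)
                     (V : Module (FiniteField.commutativeRing F) 0ℓ 0ℓ)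
                     (fin : Finite (Module.≈ᴹ-setoid V)) where

  open FiniteField F
  open Module V
  open Finite fin using (size; index; index-cong)
  open Summation +ᴹ-commutativeMonoid using (sum-cong-≋) renaming (sum to ∑ᴹ)

  private
    module F = Finite finite
    module V = Finite fin

  infix 4 _∈ᴹ_
  _∈ᴹ_ : Carrierᴹ → Subset size → Set
  v ∈ᴹ U = index v ∈ U

  record IsLinearSubspace (U : Subset size) : Set where
    field
      0ᴹ-closed : 0ᴹ ∈ᴹ U
      +ᴹ-closed : ∀ u v → u ∈ᴹ U → v ∈ᴹ U → u +ᴹ v ∈ᴹ U
      *ₗ-closed : ∀ c u → u ∈ᴹ U → c *ₗ u ∈ᴹ U

  combination : ∀ {d} → Vector Carrier d → Vector Carrierᴹ d → Carrierᴹ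
  combination c b = ∑ᴹ (λ i → c i *ₗ b i)

  record IsBasis (U : Subset size) {d} (b : Vector Carrierᴹ d) : Set where
    field
      members     : ∀ i → b i ∈ᴹ U
      independent : ∀ c → combination c b ≈ᴹ 0ᴹ → ∀ i → c i ≈ 0#
      spanning    : ∀ u → u ∈ᴹ U → ∃[ c ] combination c b ≈ᴹ u

  HasDimension : Subset size → ℕ → Set
  HasDimension U d = ∃ (IsBasis U {d})

  private
    ∈ᴹ-resp : ∀ U → (_∈ᴹ U) Respects _≈ᴹ_
    ∈ᴹ-resp U eq = ≡.subst (_∈ U) (index-cong eq)

    combination-cong : ∀ {d} {c c′ : Vector Carrier d} {b b′ : Vector Carrierᴹ d} →
                       (∀ i → c i ≈ c′ i) → (∀ i → b i ≈ᴹ b′ i) →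
                       combination c b ≈ᴹ combination c′ b′
    combination-cong c≈c′ b≈b′ = sum-cong-≋ (λ i → *ₗ-cong (c≈c′ i) (b≈b′ i))

    isBasis-resp : ∀ U {d} {b b′ : Vector Carrierᴹ d} →
                   (∀ i → b i ≈ᴹ b′ i) → IsBasis U b → IsBasis U b′
    isBasis-resp U eq basis = record
      { members     = λ i → ∈ᴹ-resp U (eq i) (members i)
      ; independent = λ c p → independent c (≈ᴹ-trans (combination-cong (λ _ → refl) eq) p)
      ; spanning    = λ u u∈U → let c , p = spanning u u∈U in
          c , ≈ᴹ-trans (combination-cong (λ _ → refl) (≈ᴹ-sym ∘ eq)) p
      }
      where open IsBasis basis

    isBasis? : ∀ U {d} (b : Vector Carrierᴹ d) → Dec (IsBasis U b)
    isBasis? U {d} b = map′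
      (λ (m , i , s) → record { members = m ; independent = i ; spanning = s })
      (λ basis → let open IsBasis basis in members , independent , spanning)
      (Fin.all? (λ i → index (b i) ∈? U)
        ×-dec Fᵈ.all?
          (λ eq p q i → trans (sym (eq i))
            (p (≈ᴹ-trans (combination-cong eq (λ _ → ≈ᴹ-refl)) q) i))
          (λ c → (combination c b V.≈? 0ᴹ) →-dec Fin.all? (λ i → c i F.≈? 0#))
        ×-dec V.all?
          (λ eq p v∈U → let c , q = p (∈ᴹ-resp U (≈ᴹ-sym eq) v∈U) in c , ≈ᴹ-trans q eq)
          (λ u → (index u ∈? U) →-dec Fᵈ.any?
            (λ eq → ≈ᴹ-trans (combination-cong (sym ∘ eq) (λ _ → ≈ᴹ-refl)))
            (λ c → combination c b V.≈? u)))
      where module Fᵈ = Finite (vectors finite d)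

  isLinearSubspace? : ∀ U → Dec (IsLinearSubspace U)
  isLinearSubspace? U = map′
    (λ (z , a , s) → record { 0ᴹ-closed = z ; +ᴹ-closed = a ; *ₗ-closed = s })
    (λ sub → let open IsLinearSubspace sub in 0ᴹ-closed , +ᴹ-closed , *ₗ-closed)
    ((index 0ᴹ ∈? U)
      ×-dec V.all?
        (λ eq p v u∈U v∈U → ∈ᴹ-resp U (+ᴹ-congʳ eq) (p v (∈ᴹ-resp U (≈ᴹ-sym eq) u∈U) v∈U))
        (λ u → V.all?
          (λ eq p u∈U v∈U → ∈ᴹ-resp U (+ᴹ-congˡ eq) (p u∈U (∈ᴹ-resp U (≈ᴹ-sym eq) v∈U)))
          (λ v → (index u ∈? U) →-dec (index v ∈? U) →-dec (index (u +ᴹ v) ∈? U)))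
      ×-dec F.all?
        (λ eq p u u∈U → ∈ᴹ-resp U (*ₗ-congʳ eq) (p u u∈U))
        (λ c → V.all?
          (λ eq p u∈U → ∈ᴹ-resp U (*ₗ-congˡ eq) (p (∈ᴹ-resp U (≈ᴹ-sym eq) u∈U)))
          (λ u → (index u ∈? U) →-dec (index (c *ₗ u) ∈? U))))

  hasDimension? : ∀ U d → Dec (HasDimension U d)
  hasDimension? U d = Finite.any? (vectors fin d) (isBasis-resp U) (isBasis? U)

-- The first constructor is the case q = 1, the second the case q ≥ 2.  A vector
-- space over a finite field is finite-dimensional exactly when it is finite; the
-- enumeration of V only serves to make sums over sets of subspaces computable.
data Space : Set₁ where
  finiteSet   : (X : Setoid 0ℓ 0ℓ) → Finite X → Space
  vectorSpace : (F : FiniteField) (V : Module (FiniteField.commutativeRing F) 0ℓ 0ℓ) →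
                Finite (Module.≈ᴹ-setoid V) → Space

card : Space → ℕ
card (finiteSet X fin)     = Finite.size fin
card (vectorSpace F V fin) = Finite.size fin

baseOrder : Space → ℕ
baseOrder (finiteSet X fin)     = 1
baseOrder (vectorSpace F V fin) = FiniteField.order F

IsSubspace : (S : Space) → Subset (card S) → Set
IsSubspace (finiteSet X fin)     U = Unit.⊤
IsSubspace (vectorSpace F V fin) U = LinearAlgebra.IsLinearSubspace F V fin U

HasRank : (S : Space) → Subset (card S) → ℕ → Set
HasRank (finiteSet X fin)     U k = ∣ U ∣ ≡ k
HasRank (vectorSpace F V fin) U k = LinearAlgebra.HasDimension F V fin U k

isSubspace? : ∀ S U → Dec (IsSubspace S U)
isSubspace? (finiteSet X fin)     U = yes Unit.tt
isSubspace? (vectorSpace F V fin) U = LinearAlgebra.isLinearSubspace? F V fin U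

hasRank? : ∀ S U k → Dec (HasRank S U k)
hasRank? (finiteSet X fin)     U k = ∣ U ∣ ℕ.≟ k
hasRank? (vectorSpace F V fin) U k = LinearAlgebra.hasDimension? F V fin U k

-- ⟦ m ⟧ q = 1 + q + ⋯ + q^(m-1)
⟦_⟧_ : ℕ → ℕ → ℕ
⟦ zero  ⟧ q = 0
⟦ suc m ⟧ q = ⟦ m ⟧ q ℕ.+ q ^ m

allSubsets : ∀ N → List (Subset N)
allSubsets zero    = [] ∷ []
allSubsets (suc N) = List.map (inside ∷_) (allSubsets N) ++ List.map (outside ∷_) (allSubsets N)

-- The subspaces of rank k contained in W.  Both ambient spaces, V and H, are
-- given as subsets W of V (V itself being ⊤).  The proof component is irrelevant,
-- so two elements are equal as soon as the underlying subsets are.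
Grassmannian : (S : Space) → Subset (card S) → ℕ → Set
Grassmannian S W k = [ U ∈ Subset (card S) ∣ IsSubspace S U × HasRank S U k × U ⊆ W ]

module _ {S : Space} where

  restrict : ∀ {W W′ k} (U : Grassmannian S W k) → value U ⊆ W′ → Grassmannian S W′ k
  restrict U U⊆W′ =
    value U , Irrelevant.map (λ (sub , rank , _) → sub , rank , λ {i} → U⊆W′ {i}) (proof U)

  weaken : ∀ {W W′ k} → W ⊆ W′ → Grassmannian S W k → Grassmannian S W′ k
  weaken W⊆W′ = refine (λ (sub , rank , U⊆W) → sub , rank , λ {i} → ⊆-trans U⊆W W⊆W′ {i})

enumerate : ∀ S W k → List (Grassmannian S W k)
enumerate S W k = List.mapMaybe
  (λ U → Maybe.map (λ p → U , [ p ])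
           (dec⇒maybe (isSubspace? S U ×-dec hasRank? S U k ×-dec (U ⊆? W))))
  (allSubsets (card S))

module Functions (ℝ : RealNumbers) (S : Space) where

  open RealNumbers ℝ public using (_≈_; _*_; _/_; -_; 1#; fromℕ)
  open RealNumbers ℝ using (Carrier; _+_; 0#; sum)

  ℝ^[_,_] : Subset (card S) → ℕ → Set
  ℝ^[ W , k ] = Grassmannian S W k → Carrier

  functionSpace : Subset (card S) → ℕ → RawLeftModule Carrier 0ℓ 0ℓ
  functionSpace W k = record
    { Carrierᴹ = ℝ^[ W , k ]
    ; _≈ᴹ_     = λ f g → ∀ K → f K ≈ g K
    ; _+ᴹ_     = λ f g K → f K + g K
    ; _*ₗ_     = λ c f K → c * f K
    ; 0ᴹ       = λ _ → 0#
    ; -ᴹ_      = λ f K → - f K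
    }

  infix 4 _≐_
  _≐_ : ∀ {W k} → ℝ^[ W , k ] → ℝ^[ W , k ] → Set
  f ≐ g = ∀ K → f K ≈ g K

  𝟎 : ∀ {W k} → ℝ^[ W , k ]
  𝟎 _ = 0#

  ∑ : ∀ {W i} → ℝ^[ W , i ] → Carrier
  ∑ {W} {i} g = sum (g ∘ List.lookup (enumerate S W i))

  𝒙 : ∀ {W i} k → Grassmannian S W i → ℝ^[ W , k ]
  𝒙 k I K with value I ⊆? value K
  ... | yes _ = 1#
  ... | no  _ = 0#

  expansion : ∀ {W i} k → ℝ^[ W , i ] → ℝ^[ W , k ]
  expansion k w K = ∑ (λ I → w I * 𝒙 k I K)

  V̄ : ∀ W i k → ℝ^[ W , k ] → Set
  V̄ W i k f = ∃[ w ] f ≐ expansion {W} {i} k w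

  -- "wt_f^{(i)} = w": w is the unique function expressing f through the 𝒙 k I.
  IsWeightDistribution : ∀ {W k} i → ℝ^[ W , k ] → ℝ^[ W , i ] → Set
  IsWeightDistribution {W} {k} i f w =
    (f ≐ expansion k w) × (∀ w′ → f ≐ expansion k w′ → w ≐ w′)

  -- "deg_W f = d" for W of rank m, with ⊥₋ standing for -∞.
  IsDegree : ∀ {W k} (m : ℕ) → ℝ^[ W , k ] → ℕ ₋ → Set
  IsDegree m f ⊥₋ = f ≐ 𝟎
  IsDegree {W} {k} m f [ t ]₋ =
    ¬ (f ≐ 𝟎) ×
    (t ℕ.≤ k ⊓ (m ∸ k)) × V̄ W t k f ×
    (∀ s → s ℕ.≤ k ⊓ (m ∸ k) → V̄ W s k f → t ℕ.≤ s)

  Ψ : ∀ {H k} → ℝ^[ H , k ] → ℝ^[ ⊤ , k ]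
  Ψ {H} f K with value K ⊆? H
  ... | yes K⊆H = f (restrict K K⊆H)
  ... | no  _   = 0#

  IsInjectiveLinear : ∀ {W W′ k k′} → (ℝ^[ W , k ] → ℝ^[ W′ , k′ ]) → Set
  IsInjectiveLinear {W} {W′} {k} {k′} =
    ModuleMorphism.IsLeftModuleMonomorphism (functionSpace W k) (functionSpace W′ k′)

  Image : ∀ {W W′ k k′} → (ℝ^[ W , k ] → ℝ^[ W′ , k′ ]) → ℝ^[ W′ , k′ ] → Set
  Image Φ g = ∃[ f ] Φ f ≐ g

  Support : ∀ {W k} → ℝ^[ W , k ] → Grassmannian S W k → Set
  Support g K = ¬ (g K ≈ 0#)

infixl 6 _+1
_+1 : ℕ ₋ → ℕ ₋
⊥₋      +1 = ⊥₋
[ t ]₋ +1 = [ suc t ]₋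

min : ℕ ₋ → ℕ → ℕ ₋
min ⊥₋     k = ⊥₋
min [ t ]₋ k = [ t ⊓ k ]₋

max0 : ℕ ₋ → ℕ
max0 ⊥₋     = 0
max0 [ t ]₋ = t

module Submission where

-- Write T_i w K for the sum of w over the rank-i subspaces of K, so that expansion k w = T_i w.
-- Everything rests on the double count, for a hyperplane H of W and L ≤ H of rank k - 1,
--
--   Σ_{K ∩ H = L} T_i w K = q^(rk H - rk L) T_i w L + T_{i-1} b L,   b(J) = Σ_{I ∩ H = J} w(I),
--
-- together with T_{i+1} (T_i w) K = [k-i] T_i w K.  If T_i w vanishes on all K ≰ H, the left side
-- is 0, which expresses both w and T_i w on H through T_{i-1} b.  Hence Ψ f cannot have degree
-- s < k unless f has degree at most s - 1 on H.  The same relation reduces the injectivity of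
-- T_i : ℝ^[W,i] → ℝ^[W,k] (i ≤ k, i + k ≤ rk W) to that of T_i in rank k - 1 and of T_{i-1} in
-- rank k, both on H.  The upper bound on the degree and the weight formula then follow by
-- expanding the stated weights.

import Algebra.Properties.CommutativeSemigroup as CommutativeSemigroupProperties
import Algebra.Properties.Group as GroupProperties
import Algebra.Properties.Ring as RingProperties
import Algebra.Properties.Semiring.Mult as Mult
open import Algebra.Bundles using (CommutativeMonoid)
open import Algebra.Module.Bundles using (Module)
import Data.Bool.Properties as Bool
open import Data.Fin.Base using (Fin; zero; suc)
import Data.Fin.Properties as Fin
open import Data.Fin.Subset using (Subset; inside; outside; _∈_; _∉_; ⊤; ⊥; _∩_; _∪_; _⊆_; ⁅_⁆; ∣_∣)
open import Data.Fin.Subset.Properties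
open import Data.Irrelevant using ([_])
open import Data.List.Base as List using (List; []; _∷_; _++_)
open import Data.Maybe.Base as Maybe using (Maybe; just; nothing; maybe′)
open import Data.Nat using (ℕ; zero; suc; _≤_; _<_; _≤′_; ≤′-refl; ≤′-step; _∸_; _⊓_; _^_;
  z≤n; s≤s; s≤s⁻¹; >-nonZero)
  renaming (_+_ to _+ℕ_; _*_ to _*ℕ_)
import Data.Nat.Properties as ℕ
open import Data.Product using (_×_; ∃-syntax; Σ-syntax; _,_; proj₁; proj₂)
open import Data.Refinement using (value) renaming (_,_ to _,ᵍ_)
open import Data.Sum using (inj₁; inj₂; [_,_]′)
open import Data.Unit.Base using (tt)
open import Data.Vec.Base using ([]; _∷_; here; there; tabulate)
open import Data.Vec.Functional using (Vector)
import Data.Vec.Properties as Vec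
open import Function.Base using (_∘_; id; const)
open import Function.Bundles using (_⇔_; mk⇔)
open import Level using (0ℓ)
import Relation.Binary.Reasoning.Setoid as SetoidReasoning
open import Relation.Binary.PropositionalEquality as ≡ using (_≡_; _≢_)
open import Relation.Binary.Structures using (IsDecTotalOrder)
open import Relation.Nullary using (¬_; Dec; yes; no; does; contradiction; ¬?; recompute)
open import Relation.Nullary.Construct.Add.Infimum using (_₋; ⊥₋) renaming ([_] to [_]₋)
open import Relation.Nullary.Decidable using (map′; _×-dec_; dec-true; dec⇒maybe; decidable-stable)
open import Defs

-- A flat of rank k off H meets H only in rank k - 1, so the double count constrains w through flats
-- of rank k - 1, whereas f lives on the flats of rank k in H. The composition rule bridges the gap:
-- in rank k - 1 the term T_{i-1} b is, up to the factor [k-i], the T_i-transform of T_{i-1} b. The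
-- double count thus says that T_i annihilates one explicit function on the rank-i flats of H, and
-- injectivity in rank k - 1 turns this into an identity between weights, which can be summed again
-- over the rank-i flats of a K of rank k. The injectivity needed is that of T_i in rank k - 1 on H,
-- with condition i + (k - 1) ≤ n - 1. This is the range i + k ≤ n in which degrees and weights are
-- considered.

_≟ˢ_ : ∀ {N} (U V : Subset N) → Dec (U ≡ V)
_≟ˢ_ = Vec.≡-dec Bool._≟_

-- Membership is decidable, so a failed inclusion yields an actual point. The points off a
-- hyperplane used below are found in this way.
⊈-witness : ∀ {N} {U V : Subset N} → ¬ (U ⊆ V) → ∃[ x ] x ∈ U × x ∉ V
⊈-witness {U = U} {V} U⊈V with Fin.any? (λ x → (x ∈? U) ×-dec ¬? (x ∈? V))
... | yes w = w
... | no ¬w = contradiction (λ {x} → below x) U⊈V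
  where
  below : ∀ x → x ∈ U → x ∈ V
  below x x∈U with x ∈? V
  ... | yes x∈V = x∈V
  ... | no  x∉V = contradiction (x , x∈U , x∉V) ¬w

-- Division in fields and characteristic 0 of the reals.

module FieldProperties (F : Field) where
  open Field F
  open SetoidReasoning setoid
  open RingProperties ring using (-‿distribˡ-*; -‿distribʳ-*) public

  *-inverseˡ : ∀ x → ¬ (x ≈ 0#) → x ⁻¹ * x ≈ 1#
  *-inverseˡ x x≉0 = trans (*-comm _ _) (*-inverseʳ x x≉0)

  cancelˡ : ∀ {x} y → ¬ (x ≈ 0#) → x ⁻¹ * (x * y) ≈ y
  cancelˡ {x} y x≉0 = begin
    x ⁻¹ * (x * y)  ≈⟨ *-assoc _ _ _ ⟨
    x ⁻¹ * x * y    ≈⟨ *-congʳ (*-inverseˡ x x≉0) ⟩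
    1# * y          ≈⟨ *-identityˡ y ⟩
    y               ∎

  x*y≈0⇒y≈0 : ∀ {x y} → ¬ (x ≈ 0#) → x * y ≈ 0# → y ≈ 0#
  x*y≈0⇒y≈0 {x} {y} x≉0 xy≈0 = begin
    y               ≈⟨ cancelˡ y x≉0 ⟨
    x ⁻¹ * (x * y)  ≈⟨ *-congˡ xy≈0 ⟩
    x ⁻¹ * 0#       ≈⟨ zeroʳ _ ⟩
    0#              ∎

  *-≉0 : ∀ {x y} → ¬ (x ≈ 0#) → ¬ (y ≈ 0#) → ¬ (x * y ≈ 0#)
  *-≉0 x≉0 y≉0 = y≉0 ∘ x*y≈0⇒y≈0 x≉0

  ⁻¹-≉0 : ∀ {x} → ¬ (x ≈ 0#) → ¬ (x ⁻¹ ≈ 0#)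
  ⁻¹-≉0 {x} x≉0 p = 0≉1 (begin
    0#        ≈⟨ zeroʳ x ⟨
    x * 0#    ≈⟨ *-congˡ p ⟨
    x * x ⁻¹  ≈⟨ *-inverseʳ x x≉0 ⟩
    1#        ∎)

module RealProperties (ℝ : RealNumbers) where
  open RealNumbers ℝ hiding (_≤_; zero)
  open RealNumbers ℝ using () renaming (_≤_ to _≤ʳ_)
  open FieldProperties realField public
  open Mult semiring using (×-homo-+; ×1-homo-*)
  open SetoidReasoning setoid
  private
    module O = IsDecTotalOrder isDecTotalOrder
  open IsDecTotalOrder isDecTotalOrder public using () renaming (_≟_ to _≈?_)

  fromℕ-+ : ∀ a b → fromℕ (a +ℕ b) ≈ fromℕ a + fromℕ b
  fromℕ-+ = ×-homo-+ 1#

  fromℕ-* : ∀ a b → fromℕ (a *ℕ b) ≈ fromℕ a * fromℕ b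
  fromℕ-* = ×1-homo-*

  0≤1 : 0# ≤ʳ 1#
  0≤1 with O.total 0# 1#
  ... | inj₁ p = p
  ... | inj₂ 1≤0 = O.≤-respʳ-≈ -1*-1≈1 (*-nonNegative 0≤-1 0≤-1)
    where
    0≤-1 : 0# ≤ʳ - 1#
    0≤-1 = O.≤-respˡ-≈ (-‿inverseʳ 1#) (O.≤-respʳ-≈ (+-identityˡ _) (+-monoˡ-≤ (- 1#) 1≤0))
    -1*-1≈1 : - 1# * - 1# ≈ 1#
    -1*-1≈1 = begin
      - 1# * - 1#        ≈⟨ -‿distribˡ-* _ _ ⟨
      - (1# * - 1#)      ≈⟨ -‿cong (*-identityˡ _) ⟩
      - (- 1#)           ≈⟨ RingProperties.-‿involutive ring 1# ⟩
      1#                 ∎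

  0≤fromℕ : ∀ a → 0# ≤ʳ fromℕ a
  0≤fromℕ zero    = O.refl
  0≤fromℕ (suc a) = O.trans (0≤fromℕ a)
    (O.≤-respˡ-≈ (+-identityˡ _) (+-monoˡ-≤ (fromℕ a) 0≤1))

  -- The order gives characteristic 0, so positive counts such as [m] with m > 0 and q^t can be
  -- divided by.
  fromℕ-≉0 : ∀ {a} → 0 < a → ¬ (fromℕ a ≈ 0#)
  fromℕ-≉0 {suc a} _ p = 0≉1 (O.antisym 0≤1 (O.≤-respʳ-≈ p
    (O.≤-respˡ-≈ (+-identityˡ _) (O.≤-respʳ-≈ (+-comm _ _) (+-monoˡ-≤ 1# (0≤fromℕ a))))))

-- Sums over decidable families of subsets.

module SubsetSums (ℝ : RealNumbers) where
  open RealNumbers ℝ hiding (_≤_; zero)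
  open CommutativeSemigroupProperties +-commutativeSemigroup using (interchange)
  open SetoidReasoning setoid

  sumAll : ∀ N → (Subset N → Carrier) → Carrier
  sumAll zero    f = f []
  sumAll (suc N) f = sumAll N (f ∘ (inside ∷_)) + sumAll N (f ∘ (outside ∷_))

  sumAll-cong : ∀ N {f g} → (∀ U → f U ≈ g U) → sumAll N f ≈ sumAll N g
  sumAll-cong zero    eq = eq []
  sumAll-cong (suc N) eq = +-cong (sumAll-cong N (eq ∘ (inside ∷_))) (sumAll-cong N (eq ∘ (outside ∷_)))

  sumAll-0 : ∀ N {f} → (∀ U → f U ≈ 0#) → sumAll N f ≈ 0#
  sumAll-0 zero    eq = eq []
  sumAll-0 (suc N) eq = trans
    (+-cong (sumAll-0 N (eq ∘ (inside ∷_))) (sumAll-0 N (eq ∘ (outside ∷_)))) (+-identityˡ 0#)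

  sumAll-+ : ∀ N f g → sumAll N (λ U → f U + g U) ≈ sumAll N f + sumAll N g
  sumAll-+ zero    f g = refl
  sumAll-+ (suc N) f g = trans (+-cong (sumAll-+ N _ _) (sumAll-+ N _ _)) (interchange _ _ _ _)

  sumAll-* : ∀ N c f → sumAll N (λ U → c * f U) ≈ c * sumAll N f
  sumAll-* zero    c f = refl
  sumAll-* (suc N) c f = trans (+-cong (sumAll-* N c _) (sumAll-* N c _)) (sym (distribˡ _ _ _))

  sumAll-swap : ∀ M N (f : Subset M → Subset N → Carrier) →
                sumAll M (λ U → sumAll N (f U)) ≈ sumAll N (λ V → sumAll M (λ U → f U V))
  sumAll-swap zero    N f = refl
  sumAll-swap (suc M) N f = trans (+-cong (sumAll-swap M N _) (sumAll-swap M N _)) (sym (sumAll-+ N _ _))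

  sumAll-single : ∀ N U₀ {f} → (∀ U → U ≢ U₀ → f U ≈ 0#) → sumAll N f ≈ f U₀
  sumAll-single zero    []            eq = refl
  sumAll-single (suc N) (inside ∷ U₀) eq = trans
    (+-cong (sumAll-single N U₀ (λ U U≢U₀ → eq _ (U≢U₀ ∘ Vec.∷-injectiveʳ))) (sumAll-0 N (λ U → eq _ λ ())))
    (+-identityʳ _)
  sumAll-single (suc N) (outside ∷ U₀) eq = trans
    (+-cong (sumAll-0 N (λ U → eq _ λ ())) (sumAll-single N U₀ (λ U U≢U₀ → eq _ (U≢U₀ ∘ Vec.∷-injectiveʳ))))
    (+-identityˡ _)

  when : ∀ {P : Set} → Dec P → Carrier → Carrier
  when (yes _) x = x
  when (no  _) x = 0#

  when-yes : ∀ {P : Set} (P? : Dec P) {x} → P → when P? x ≈ x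
  when-yes (yes _) p = refl
  when-yes (no ¬p) p = contradiction p ¬p

  when-no : ∀ {P : Set} (P? : Dec P) {x} → ¬ P → when P? x ≈ 0#
  when-no (yes p) ¬p = contradiction p ¬p
  when-no (no _)  ¬p = refl

  when-cong : ∀ {P Q : Set} (P? : Dec P) (Q? : Dec Q) {x y} →
              (P → Q) → (Q → P) → (P → x ≈ y) → when P? x ≈ when Q? y
  when-cong (yes p) Q? to from eq = trans (eq p) (sym (when-yes Q? (to p)))
  when-cong (no ¬p) Q? to from eq = sym (when-no Q? (¬p ∘ from))

  module _ {N : ℕ} where

    -- Keeping the index set fixed and cutting down the summand makes interchange of sums a plain
    -- swap, and families with equivalent predicates get equal sums without any bijection.
    Σ : {P : Subset N → Set} → (∀ U → Dec (P U)) → (Subset N → Carrier) → Carrier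
    Σ P? f = sumAll N (λ U → when (P? U) (f U))

    module _ {P : Subset N → Set} (P? : ∀ U → Dec (P U)) where

      Σ-+ : ∀ f g → Σ P? (λ U → f U + g U) ≈ Σ P? f + Σ P? g
      Σ-+ f g = trans (sumAll-cong N split) (sumAll-+ N _ _)
        where
        split : ∀ U → when (P? U) (f U + g U) ≈ when (P? U) (f U) + when (P? U) (g U)
        split U with P? U
        ... | yes _ = refl
        ... | no  _ = sym (+-identityˡ 0#)

      Σ-* : ∀ c f → Σ P? (λ U → c * f U) ≈ c * Σ P? f
      Σ-* c f = trans (sumAll-cong N pull) (sumAll-* N c _)
        where
        pull : ∀ U → when (P? U) (c * f U) ≈ c * when (P? U) (f U)
        pull U with P? U
        ... | yes _ = refl
        ... | no  _ = sym (zeroʳ c)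

      Σ-const : ∀ c → Σ P? (λ _ → c) ≈ c * Σ P? (λ _ → 1#)
      Σ-const c = trans (sumAll-cong N λ U → when-cong (P? U) (P? U) id id (λ _ → sym (*-identityʳ c)))
                        (Σ-* c (λ _ → 1#))

      Σ-0 : ∀ {f} → (∀ U → P U → f U ≈ 0#) → Σ P? f ≈ 0#
      Σ-0 {f} eq = sumAll-0 N vanish
        where
        vanish : ∀ U → when (P? U) (f U) ≈ 0#
        vanish U with P? U
        ... | yes p = eq U p
        ... | no  _ = refl

      Σ-single : ∀ {U₀} f → P U₀ → (∀ U → P U → U ≡ U₀) → Σ P? f ≈ f U₀
      Σ-single {U₀} f p unique =
        trans (sumAll-single N U₀ (λ U U≢U₀ → when-no (P? U) (λ p′ → U≢U₀ (unique U p′))))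
              (when-yes (P? U₀) p)

      module _ {Q : Subset N → Set} (Q? : ∀ U → Dec (Q U)) where

        Σ-cong : ∀ {f g} → (∀ U → P U → Q U) → (∀ U → Q U → P U) →
                 (∀ U → P U → f U ≈ g U) → Σ P? f ≈ Σ Q? g
        Σ-cong to from eq = sumAll-cong N (λ U → when-cong (P? U) (Q? U) (to U) (from U) (eq U))

        Σ-split : ∀ f → Σ P? f ≈ Σ (λ U → P? U ×-dec Q? U) f + Σ (λ U → P? U ×-dec ¬? (Q? U)) f
        Σ-split f = trans (sumAll-cong N split) (sumAll-+ N _ _)
          where
          split : ∀ U → when (P? U) (f U) ≈
                        when (P? U ×-dec Q? U) (f U) + when (P? U ×-dec ¬? (Q? U)) (f U)
          split U with P? U | Q? U
          ... | yes _ | yes _ = sym (+-identityʳ _)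
          ... | yes _ | no  _ = sym (+-identityˡ _)
          ... | no  _ | yes _ = sym (+-identityˡ _)
          ... | no  _ | no  _ = sym (+-identityˡ _)

    Σ-congˡ : ∀ {P : Subset N → Set} (P? : ∀ U → Dec (P U)) {f g} →
              (∀ U → P U → f U ≈ g U) → Σ P? f ≈ Σ P? g
    Σ-congˡ P? = Σ-cong P? P? (λ _ → id) (λ _ → id)

    when-Σ : ∀ {A : Set} (A? : Dec A) {Q : Subset N → Set} (Q? : ∀ V → Dec (Q V)) f →
             when A? (Σ Q? f) ≈ Σ (λ V → A? ×-dec Q? V) f
    when-Σ (yes a) Q? f =
      Σ-cong Q? (λ V → yes a ×-dec Q? V) {f} {f} (λ _ q → a , q) (λ _ → proj₂) (λ _ _ → refl)
    when-Σ (no ¬a) Q? f = sym (Σ-0 (λ V → no ¬a ×-dec Q? V) {f} (λ _ (a , _) → contradiction a ¬a))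

    -- Only the two sets of pairs have to agree, not the way they are split into outer and inner
    -- condition. In each double count below, the last two arguments carry the geometry.
    Σ-swap : ∀ {P : Subset N → Set} {Q : Subset N → Subset N → Set}
               {P′ : Subset N → Set} {Q′ : Subset N → Subset N → Set}
             (P? : ∀ U → Dec (P U)) (Q? : ∀ U V → Dec (Q U V))
             (P′? : ∀ V → Dec (P′ V)) (Q′? : ∀ V U → Dec (Q′ V U)) (f : Subset N → Subset N → Carrier) →
             (∀ U V → P U × Q U V → P′ V × Q′ V U) → (∀ U V → P′ V × Q′ V U → P U × Q U V) →
             Σ P? (λ U → Σ (Q? U) (f U)) ≈ Σ P′? (λ V → Σ (Q′? V) (λ U → f U V))
    Σ-swap P? Q? P′? Q′? f to from = begin
      Σ P? (λ U → Σ (Q? U) (f U))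
        ≈⟨ sumAll-cong N (λ U → when-Σ (P? U) (Q? U) (f U)) ⟩
      sumAll N (λ U → sumAll N (λ V → when (P? U ×-dec Q? U V) (f U V)))
        ≈⟨ sumAll-swap N N _ ⟩
      sumAll N (λ V → sumAll N (λ U → when (P? U ×-dec Q? U V) (f U V)))
        ≈⟨ sumAll-cong N (λ V → sumAll-cong N (λ U →
             when-cong (P? U ×-dec Q? U V) (P′? V ×-dec Q′? V U) (to U V) (from U V) (λ _ → refl))) ⟩
      sumAll N (λ V → sumAll N (λ U → when (P′? V ×-dec Q′? V U) (f U V)))
        ≈⟨ sumAll-cong N (λ V → when-Σ (P′? V) (Q′? V) (λ U → f U V)) ⟨
      Σ P′? (λ V → Σ (Q′? V) (λ U → f U V)) ∎

    Σ-count : ∀ q {P : Subset N → Set} (P? : ∀ U → Dec (P U)) (κ : Fin q → Subset N) →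
              (∀ {c c′} → κ c ≡ κ c′ → c ≡ c′) → (∀ c → P (κ c)) → (∀ U → P U → ∃[ c ] U ≡ κ c) →
              Σ P? (λ _ → 1#) ≈ fromℕ q
    Σ-count zero P? κ inj Pκ surj = Σ-0 P? (λ U p → contradiction (proj₁ (surj U p)) λ ())
    Σ-count (suc q) {P} P? κ inj Pκ surj = begin
      Σ P? (λ _ → 1#)
        ≈⟨ Σ-split P? (_≟ˢ κ zero) (λ _ → 1#) ⟩
      Σ (λ U → P? U ×-dec (U ≟ˢ κ zero)) (λ _ → 1#) + Σ (λ U → P? U ×-dec ¬? (U ≟ˢ κ zero)) (λ _ → 1#)
        ≈⟨ +-cong (Σ-single (λ U → P? U ×-dec (U ≟ˢ κ zero)) (λ _ → 1#) (Pκ zero , ≡.refl) (λ _ → proj₂))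
             (Σ-count q (λ U → P? U ×-dec ¬? (U ≟ˢ κ zero)) (κ ∘ suc)
               (Fin.suc-injective ∘ inj)
               (λ c → Pκ (suc c) , λ eq → Fin.0≢1+n (≡.sym (inj eq)))
               rest) ⟩
      1# + fromℕ q ∎
      where
      rest : ∀ U → P U × U ≢ κ zero → ∃[ c ] U ≡ κ (suc c)
      rest U (p , U≢) with surj U p
      ... | zero  , eq = contradiction eq U≢
      ... | suc c , eq = c , eq

-- The part of (modular) matroid theory shared by q = 1 and q ≥ 2: U ⊕ p is the
-- join of U with the point p, and `pencil` lists, through the points κ c, the q
-- complements of (G ⊕ h) / G in the rank-2 quotient ((G ⊕ h) ⊕ p) / G.
record SubspaceLaws (S : Space) : Set where
  infixl 6 _⊕_
  field
    _⊕_       : Subset (card S) → Fin (card S) → Subset (card S)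
    ⊕-sub     : ∀ {U p} → IsSubspace S U → IsSubspace S (U ⊕ p)
    ⊆-⊕       : ∀ {U p} → IsSubspace S U → U ⊆ U ⊕ p
    ∈-⊕       : ∀ {U p} → IsSubspace S U → p ∈ U ⊕ p
    ⊕-least   : ∀ {U p X} → IsSubspace S X → U ⊆ X → p ∈ X → U ⊕ p ⊆ X
    ⊕-modular : ∀ {H K p x} → IsSubspace S K → x ∈ H ⊕ p → x ∈ K → p ∈ K → x ∈ (K ∩ H) ⊕ p
    ⊕-rank    : ∀ {U p d} → IsSubspace S U → HasRank S U d → p ∉ U → HasRank S (U ⊕ p) (suc d)
    rank-mono : ∀ {K U k d} → IsSubspace S K → HasRank S K k → HasRank S U d → K ⊆ U → k ≤ d
    ∩-sub     : ∀ {U V} → IsSubspace S U → IsSubspace S V → IsSubspace S (U ∩ V)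
    ⊤-sub     : IsSubspace S ⊤
    𝟘         : Subset (card S)
    𝟘-sub     : IsSubspace S 𝟘
    𝟘-rank    : HasRank S 𝟘 0
    𝟘-least   : ∀ {U} → IsSubspace S U → 𝟘 ⊆ U
    1≤q       : 1 ≤ baseOrder S
    pencil    : ∀ {G h p} → IsSubspace S G → h ∉ G → p ∉ G ⊕ h →
                Σ[ κ ∈ (Fin (baseOrder S) → Fin (card S)) ]
                  (∀ c → κ c ∈ (G ⊕ h) ⊕ p)
                × (∀ c → κ c ∉ G ⊕ h)
                × (∀ c c′ → κ c ∈ G ⊕ κ c′ → c ≡ c′)
                × (∀ x → x ∈ (G ⊕ h) ⊕ p → x ∉ G ⊕ h → ∃[ c ] κ c ∈ G ⊕ x)

-- Unlike the proof inside a `Grassmannian`, these data are relevant and may be computed with;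
-- decidability connects the two.
record Flat (S : Space) (W : Subset (card S)) (k : ℕ) (U : Subset (card S)) : Set where
  constructor flat
  field
    sub   : IsSubspace S U
    rank  : HasRank S U k
    below : U ⊆ W

flat? : ∀ S W k U → Dec (Flat S W k U)
flat? S W k U = map′ (λ (s , r , b) → flat s r b) (λ (flat s r b) → s , r , λ {x} → b {x})
                     (isSubspace? S U ×-dec hasRank? S U k ×-dec (U ⊆? W))

-- Ranks, hyperplanes, meets and joins.

module Geometry (S : Space) (laws : SubspaceLaws S) {n : ℕ} (⊤-rank : HasRank S ⊤ n) where
  open SubspaceLaws laws public
  open Flat

  private
    variable
      H I J K L U V W : Subset (card S)
      i j k ℓ m d : ℕ

  flat-⊆ : V ⊆ W → Flat S V k U → Flat S W k U
  flat-⊆ V⊆W (flat s r b) = flat s r (⊆-trans b V⊆W)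

  flat-self : IsSubspace S U → HasRank S U d → Flat S U d U
  flat-self s r = flat s r ⊆-refl

  rank-unique : IsSubspace S U → HasRank S U i → HasRank S U j → i ≡ j
  rank-unique s r r′ = ℕ.≤-antisym (rank-mono s r r′ ⊆-refl) (rank-mono s r′ r ⊆-refl)

  -- A point of `U` missing from `K` could be joined to `K`, giving rank `d + 1` inside `U`. Most
  -- equalities of subspaces below are obtained from this.
  equal-rank : IsSubspace S K → HasRank S K d → HasRank S U d → IsSubspace S U → K ⊆ U → K ≡ U
  equal-rank {K} {d} {U} sK rK rU sU K⊆U = ⊆-antisym K⊆U (λ {x} → U⊆K x)
    where
    U⊆K : ∀ x → x ∈ U → x ∈ K
    U⊆K x x∈U with x ∈? K
    ... | yes x∈K = x∈K
    ... | no  x∉K = contradiction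
      (rank-mono (⊕-sub sK) (⊕-rank sK rK x∉K) rU (⊕-least sU K⊆U x∈U)) (ℕ.<-irrefl ≡.refl)

  between : IsSubspace S W → HasRank S W m → Flat S W i I → i ≤ j → j ≤ m →
            ∃[ J ] Flat S W j J × I ⊆ J
  between {W} {m} sW rW f i≤j j≤m with ℕ.≤⇒≤′ i≤j
  ... | i≤′j = climb f i≤′j j≤m
    where
    climb : ∀ {I i j} → Flat S W i I → i ≤′ j → j ≤ m → ∃[ J ] Flat S W j J × I ⊆ J
    climb {I} f ≤′-refl       j≤m = I , f , ⊆-refl
    climb {I} f (≤′-step i≤j) j≤m with climb f i≤j (ℕ.<⇒≤ j≤m)
    ... | J , fJ , I⊆J with W ⊆? J
    ...   | yes W⊆J = contradiction (ℕ.≤-trans j≤m (rank-mono sW rW (rank fJ) W⊆J)) (ℕ.<-irrefl ≡.refl)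
    ...   | no  W⊈J with ⊈-witness W⊈J
    ...     | p , p∈W , p∉J =
      J ⊕ p , flat (⊕-sub (sub fJ)) (⊕-rank (sub fJ) (rank fJ) p∉J) (⊕-least sW (below fJ) p∈W)
            , ⊆-trans I⊆J (⊆-⊕ (sub fJ))

  -- Points of `U` are joined to `𝟘` until they exhaust `U`. The fuel `t` starts at `n` and keeps
  -- `n ≤ t + a`; once it is used up, one more point would exceed the rank of `⊤`.
  hasRank : IsSubspace S U → ∃[ d ] HasRank S U d
  hasRank {U} sU = grow n (flat 𝟘-sub 𝟘-rank (𝟘-least sU)) (ℕ.≤-reflexive (≡.sym (ℕ.+-identityʳ n)))
    where
    grow : ∀ t {A a} → Flat S U a A → n ≤ t +ℕ a → ∃[ d ] HasRank S U d
    grow t {A} {a} f n≤ with U ⊆? A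
    ... | yes U⊆A = a , ≡.subst (λ X → HasRank S X a) (⊆-antisym (below f) U⊆A) (rank f)
    ... | no  U⊈A with ⊈-witness U⊈A
    ...   | p , p∈U , p∉A with t
    ...     | zero = contradiction
      (ℕ.≤-trans (rank-mono (⊕-sub (sub f)) (⊕-rank (sub f) (rank f) p∉A) ⊤-rank ⊆⊤) n≤) (ℕ.<-irrefl ≡.refl)
    ...     | suc t′ = grow t′
      (flat (⊕-sub (sub f)) (⊕-rank (sub f) (rank f) p∉A) (⊕-least sU (below f) p∈U))
      (ℕ.≤-trans n≤ (ℕ.≤-reflexive (≡.sym (ℕ.+-suc t′ a))))

  record Hyperplane (W H : Subset (card S)) (m : ℕ) : Set where
    constructor hyperplane
    field
      ambient      : IsSubspace S W
      ambient-rank : HasRank S W (suc m)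
      isFlat       : Flat S W m H

  open Hyperplane public

  hyperplane-⊕ : Hyperplane W H m → ∀ {p} → p ∈ W → p ∉ H → H ⊕ p ≡ W
  hyperplane-⊕ (hyperplane sW rW (flat sH rH H⊆W)) p∈W p∉H =
    equal-rank (⊕-sub sH) (⊕-rank sH rH p∉H) rW sW (⊕-least sW H⊆W p∈W)

  hyperplane-meet : Hyperplane W H m → IsSubspace S K → K ⊆ W → ∀ {p} → p ∈ K → p ∉ H →
                    K ≡ (K ∩ H) ⊕ p
  hyperplane-meet {H = H} {K = K} hyp sK K⊆W {p} p∈K p∉H = ⊆-antisym
    (λ x∈K → ⊕-modular sK (≡.subst (_ ∈_) (≡.sym (hyperplane-⊕ hyp (K⊆W p∈K) p∉H)) (K⊆W x∈K)) x∈K p∈K)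
    (⊕-least sK (p∩q⊆p K H) p∈K)

  -- For `p` in `K` off `H` the modular law gives `K = (K ∩ H) ⊕ p`, so the ranks differ by exactly
  -- one; in particular `k` is positive.
  meet-flat : Hyperplane W H m → Flat S W k K → ¬ (K ⊆ H) → ∃[ j ] k ≡ suc j × Flat S H j (K ∩ H)
  meet-flat {H = H} {k = k} {K = K} hyp (flat sK rK K⊆W) K⊈H with ⊈-witness K⊈H | ∩-sub sK (sub (isFlat hyp))
  ... | p , p∈K , p∉H | s with hasRank s
  ...   | j , r = j , rank-unique sK rK
                        (≡.subst (λ X → HasRank S X (suc j)) (≡.sym (hyperplane-meet hyp sK K⊆W p∈K p∉H))
                          (⊕-rank s r (p∉H ∘ p∩q⊆q K H)))
                    , flat s r (p∩q⊆q K H)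

  meet-flat-suc : Hyperplane W H m → Flat S W (suc j) K → ¬ (K ⊆ H) → Flat S H j (K ∩ H)
  meet-flat-suc hyp f K⊈H with meet-flat hyp f K⊈H
  ... | _ , ≡.refl , g = g

  -- For `L` of rank `ℓ` in a hyperplane `H` these are the points of the quotient W / L off H / L:
  -- an affine space when q ≥ 2, a single point when q = 1.
  Above : (W H L : Subset (card S)) (ℓ : ℕ) (K : Subset (card S)) → Set
  Above W H L ℓ K = Flat S W (suc ℓ) K × K ∩ H ≡ L

  above? : ∀ W H L ℓ K → Dec (Above W H L ℓ K)
  above? W H L ℓ K = flat? S W (suc ℓ) K ×-dec ((K ∩ H) ≟ˢ L)

  ∩-absorb : K ⊆ H → K ⊆ K ∩ H
  ∩-absorb K⊆H x∈K = x∈p∩q⁺ (x∈K , K⊆H x∈K)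

  above-⊆ : Above W H L ℓ K → L ⊆ K
  above-⊆ {H = H} {K = K} (_ , ≡.refl) = p∩q⊆p K H

  above-⊈ : Flat S H ℓ L → Above W H L ℓ K → ¬ (K ⊆ H)
  above-⊈ {H = H} {K = K} fL (fK , eq) K⊆H = ℕ.<-irrefl ≡.refl
    (rank-mono (sub fK) (rank fK) (rank fL) (≡.subst (K ⊆_) eq (∩-absorb K⊆H)))

  -- Such a flat contains `L` and a point `p` of `I` off `H`, so by rank it is `L ⊕ p`. Conversely
  -- `I = (I ∩ H) ⊕ p` lies in `L ⊕ p`.
  join : Hyperplane W H m → Flat S H ℓ L → IsSubspace S I → I ⊆ W → ¬ (I ⊆ H) → I ∩ H ⊆ L →
         ∃[ K ] (Above W H L ℓ K × I ⊆ K) × (∀ K′ → Above W H L ℓ K′ × I ⊆ K′ → K′ ≡ K)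
  join {W} {H} {m} {ℓ} {L} {I} hyp fL sI I⊆W I⊈H I∩H⊆L with ⊈-witness I⊈H
  ... | p , p∈I , p∉H = P , ((fP , P∩H≡L) , I⊆P) , unique
    where
    P = L ⊕ p
    p∉L : p ∉ L
    p∉L = p∉H ∘ below fL
    fP : Flat S W (suc ℓ) P
    fP = flat (⊕-sub (sub fL)) (⊕-rank (sub fL) (rank fL) p∉L)
              (⊕-least (ambient hyp) (⊆-trans (below fL) (below (isFlat hyp))) (I⊆W p∈I))
    I⊆P : I ⊆ P
    I⊆P x∈I = ⊕-least (sub fP) (⊆-trans I∩H⊆L (⊆-⊕ (sub fL))) (∈-⊕ (sub fL))
                (≡.subst (_ ∈_) (hyperplane-meet hyp sI I⊆W p∈I p∉H) x∈I)
    P∩H≡L : P ∩ H ≡ L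
    P∩H≡L = ≡.sym (equal-rank (sub fL) (rank fL) (rank f) (sub f)
                     (λ x∈L → x∈p∩q⁺ (⊆-⊕ (sub fL) x∈L , below fL x∈L)))
      where f = meet-flat-suc hyp fP (λ P⊆H → p∉H (P⊆H (∈-⊕ (sub fL))))
    unique : ∀ K′ → Above W H L ℓ K′ × I ⊆ K′ → K′ ≡ P
    unique K′ (a@(fK′ , _) , I⊆K′) = ≡.sym
      (equal-rank (sub fP) (rank fP) (rank fK′) (sub fK′) (⊕-least (sub fK′) (above-⊆ a) (I⊆K′ p∈I)))

-- Counting flats above a given flat.

module Counting (ℝ : RealNumbers) (S : Space) (laws : SubspaceLaws S) {n : ℕ} (⊤-rank : HasRank S ⊤ n) where
  open RealNumbers ℝ hiding (_≤_; zero)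
  open RealProperties ℝ
  open SubsetSums ℝ
  open Geometry S laws ⊤-rank
  open Flat
  open SetoidReasoning setoid

  private
    q = baseOrder S
    variable
      G H I K L W : Subset (card S)
      i k ℓ m : ℕ

  count-pencil : Hyperplane W H (suc ℓ) → Flat S H ℓ G → Σ (above? W H G ℓ) (λ _ → 1#) ≈ fromℕ q
  count-pencil {W} {H} {ℓ} {G} hyp fG = count
    where
    sG = sub fG
    H⊈G : ¬ (H ⊆ G)
    H⊈G H⊆G = ℕ.<-irrefl ≡.refl (rank-mono (sub (isFlat hyp)) (rank (isFlat hyp)) (rank fG) H⊆G)
    W⊈H : ¬ (W ⊆ H)
    W⊈H W⊆H = ℕ.<-irrefl ≡.refl (rank-mono (ambient hyp) (ambient-rank hyp) (rank (isFlat hyp)) W⊆H)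

    count : Σ (above? W H G ℓ) (λ _ → 1#) ≈ fromℕ q
    count with ⊈-witness H⊈G | ⊈-witness W⊈H
    ... | h , h∈H , h∉G | p , p∈W , p∉H
      with hyperplane-⊕ (hyperplane (sub (isFlat hyp)) (rank (isFlat hyp)) fG) h∈H h∉G
    -- The two matches turn `H` into `G ⊕ h` and `W` into `(G ⊕ h) ⊕ p`, the exact shape required by
    -- `pencil`.
    ... | ≡.refl with hyperplane-⊕ hyp p∈W p∉H
    ... | ≡.refl with pencil sG h∉G p∉H
    ... | κ , κ∈W , κ∉H , κ-injective , κ-surjective =
      Σ-count q (above? W H G ℓ) (λ c → G ⊕ κ c)
        (λ {c} {c′} eq → κ-injective c c′ (≡.subst (κ c ∈_) eq (∈-⊕ sG)))
        above-κ
        λ K a@(fK , K∩H≡G) → let x , x∈K , x∉H = ⊈-witness (above-⊈ fG a)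
                                 c , κc∈ = κ-surjective x (below fK x∈K) x∉H
                             in c , ≡.sym (equal-rank (⊕-sub sG) (rank-κ c) (rank fK) (sub fK)
                                      (⊕-least (sub fK) (above-⊆ a)
                                        (⊕-least (sub fK) (above-⊆ a) x∈K κc∈)))
      where
      rank-κ : ∀ c → HasRank S (G ⊕ κ c) (suc ℓ)
      rank-κ c = ⊕-rank sG (rank fG) (κ∉H c ∘ ⊆-⊕ sG)
      above-κ : ∀ c → Above W H G ℓ (G ⊕ κ c)
      above-κ c = fK , ≡.sym (equal-rank sG (rank fG) (rank f) (sub f)
                     (λ x∈G → x∈p∩q⁺ (⊆-⊕ sG x∈G , below fG x∈G)))
        where
        fK = flat (⊕-sub sG) (rank-κ c)
          (⊕-least (ambient hyp) (⊆-trans (below fG) (below (isFlat hyp))) (κ∈W c))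
        f = meet-flat-suc hyp fK (λ K⊆H → κ∉H c (K⊆H (∈-⊕ sG)))

  -- For L ≤ G < H with G a hyperplane of H, send K to the join of K and G, which meets H in G.
  count-above′ : ∀ t → Hyperplane W H (t +ℕ ℓ) → Flat S H ℓ L →
                 Σ (above? W H L ℓ) (λ _ → 1#) ≈ fromℕ (q ^ t)
  count-above′ {W} {H} {ℓ} {L} zero hyp fL =
    trans (Σ-single (above? W H L ℓ) {W} (λ _ → 1#) (flat-self (ambient hyp) (ambient-rank hyp) , W∩H≡L)
            (λ U (fU , _) → equal-rank (sub fU) (rank fU) (ambient-rank hyp) (ambient hyp) (below fU)))
          (sym (+-identityʳ 1#))
    where
    W∩H≡L : W ∩ H ≡ L
    W∩H≡L = ≡.trans (⊆-antisym (p∩q⊆q W H) (λ x∈H → x∈p∩q⁺ (below (isFlat hyp) x∈H , x∈H)))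
                    (≡.sym (equal-rank (sub fL) (rank fL) (rank (isFlat hyp)) (sub (isFlat hyp)) (below fL)))
  count-above′ {W} {H} {ℓ} {L} (suc t) hyp fL
    with between (sub (isFlat hyp)) (rank (isFlat hyp)) fL (ℕ.m≤n+m ℓ t) (ℕ.n≤1+n (t +ℕ ℓ))
  ... | G , fG , L⊆G = begin
    Σ (above? W H L ℓ) (λ _ → 1#)
      ≈⟨ Σ-congˡ (above? W H L ℓ) (λ K a → let M , aM , unique = joinG a in
           Σ-single (λ M → above? W H G (t +ℕ ℓ) M ×-dec (K ⊆? M)) {M} (λ _ → 1#) aM unique) ⟨
    Σ (above? W H L ℓ) (λ K → Σ (λ M → above? W H G (t +ℕ ℓ) M ×-dec (K ⊆? M)) (λ _ → 1#))
      ≈⟨ Σ-swap (above? W H L ℓ) (λ K M → above? W H G (t +ℕ ℓ) M ×-dec (K ⊆? M))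
           (above? W H G (t +ℕ ℓ)) (λ M → above? M G L ℓ) (λ _ _ → 1#) to from ⟩
    Σ (above? W H G (t +ℕ ℓ)) (λ M → Σ (above? M G L ℓ) (λ _ → 1#))
      ≈⟨ Σ-congˡ (above? W H G (t +ℕ ℓ)) (λ M a@(fM , _) →
           count-above′ t (hyperplane (sub fM) (rank fM) (flat (sub fG) (rank fG) (above-⊆ a)))
             (flat (sub fL) (rank fL) L⊆G)) ⟩
    Σ (above? W H G (t +ℕ ℓ)) (λ M → fromℕ (q ^ t))
      ≈⟨ Σ-const (above? W H G (t +ℕ ℓ)) _ ⟩
    fromℕ (q ^ t) * Σ (above? W H G (t +ℕ ℓ)) (λ _ → 1#)
      ≈⟨ *-congˡ (count-pencil hyp fG) ⟩
    fromℕ (q ^ t) * fromℕ q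
      ≈⟨ *-comm _ _ ⟩
    fromℕ q * fromℕ (q ^ t)
      ≈⟨ fromℕ-* q (q ^ t) ⟨
    fromℕ (q ^ suc t) ∎
    where
    joinG : Above W H L ℓ K → ∃[ M ] (Above W H G (t +ℕ ℓ) M × K ⊆ M) ×
                              (∀ M′ → Above W H G (t +ℕ ℓ) M′ × K ⊆ M′ → M′ ≡ M)
    joinG a@(fK , eq) = join hyp fG (sub fK) (below fK) (above-⊈ fL a) (≡.subst (_⊆ G) (≡.sym eq) L⊆G)

    to : ∀ K M → Above W H L ℓ K × Above W H G (t +ℕ ℓ) M × K ⊆ M →
         Above W H G (t +ℕ ℓ) M × Above M G L ℓ K
    to K M (aK@(fK , K∩H≡L) , aM , K⊆M) = aM , flat (sub fK) (rank fK) K⊆M , ⊆-antisym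
      (λ x∈ → let x∈K , x∈G = x∈p∩q⁻ K G x∈ in
              ≡.subst (_ ∈_) K∩H≡L (x∈p∩q⁺ (x∈K , below fG x∈G)))
      (λ x∈L → x∈p∩q⁺ (above-⊆ aK x∈L , L⊆G x∈L))

    from : ∀ K M → Above W H G (t +ℕ ℓ) M × Above M G L ℓ K →
           Above W H L ℓ K × Above W H G (t +ℕ ℓ) M × K ⊆ M
    from K M (aM@(fM , M∩H≡G) , aK@(fK , K∩G≡L)) =
      (flat-⊆ (below fM) fK , ⊆-antisym
        (λ x∈ → let x∈K , x∈H = x∈p∩q⁻ K H x∈ in
                ≡.subst (_ ∈_) K∩G≡L (x∈p∩q⁺ (x∈K , ≡.subst (_ ∈_) M∩H≡G (x∈p∩q⁺ (below fK x∈K , x∈H)))))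
        (λ x∈L → x∈p∩q⁺ (above-⊆ aK x∈L , below fL x∈L)))
      , aM , below fK

  count-above : Hyperplane W H m → Flat S H ℓ L → Σ (above? W H L ℓ) (λ _ → 1#) ≈ fromℕ (q ^ (m ∸ ℓ))
  count-above {m = m} {ℓ = ℓ} hyp fL = count-above′ (m ∸ ℓ)
    (≡.subst (Hyperplane _ _) (≡.sym (ℕ.m∸n+n≡m
      (rank-mono (sub fL) (rank fL) (rank (isFlat hyp)) (below fL)))) hyp) fL

  over? : ∀ K i I J → Dec (Flat S K i J × I ⊆ J)
  over? K i I J = flat? S K i J ×-dec (I ⊆? J)

  -- Fix a hyperplane `H` of `K` through `I`. The flats inside `H` are counted by induction, and
  -- those off `H` have trace `I`, so there are q^t of them; this is the recursion of the bracket.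
  count-over′ : ∀ t → IsSubspace S K → HasRank S K (t +ℕ i) → Flat S K i I →
                Σ (over? K (suc i) I) (λ _ → 1#) ≈ fromℕ (⟦ t ⟧ q)
  count-over′ {K} {i} {I} zero sK rK fI = Σ-0 (over? K (suc i) I) (λ J (fJ , _) →
    contradiction (rank-mono (sub fJ) (rank fJ) rK (below fJ)) (ℕ.<-irrefl ≡.refl))
  count-over′ {K} {i} {I} (suc t) sK rK fI
    with between sK rK fI (ℕ.m≤n+m i t) (ℕ.n≤1+n (t +ℕ i))
  ... | H , fH , I⊆H = begin
    Σ (over? K (suc i) I) (λ _ → 1#)
      ≈⟨ Σ-split (over? K (suc i) I) (_⊆? H) (λ _ → 1#) ⟩
    Σ (λ J → over? K (suc i) I J ×-dec (J ⊆? H)) (λ _ → 1#) +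
    Σ (λ J → over? K (suc i) I J ×-dec ¬? (J ⊆? H)) (λ _ → 1#)
      ≈⟨ +-cong
          (Σ-cong (λ J → over? K (suc i) I J ×-dec (J ⊆? H)) (over? H (suc i) I) {g = λ _ → 1#}
            (λ J ((fJ , I⊆J) , J⊆H) → flat (sub fJ) (rank fJ) J⊆H , I⊆J)
            (λ J (fJ , I⊆J) → (flat-⊆ (below fH) fJ , I⊆J) , below fJ)
            (λ _ _ → refl))
          (Σ-cong (λ J → over? K (suc i) I J ×-dec ¬? (J ⊆? H)) (above? K H I i) {g = λ _ → 1#}
            (λ J ((fJ , I⊆J) , J⊈H) → fJ , meets J fJ I⊆J J⊈H)
            (λ J a → (proj₁ a , above-⊆ a) , above-⊈ fI′ a)
            (λ _ _ → refl)) ⟩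
    Σ (over? H (suc i) I) (λ _ → 1#) + Σ (above? K H I i) (λ _ → 1#)
      ≈⟨ +-cong (count-over′ t (sub fH) (rank fH) fI′) (count-above′ t hyp fI′) ⟩
    fromℕ (⟦ t ⟧ q) + fromℕ (q ^ t)
      ≈⟨ fromℕ-+ (⟦ t ⟧ q) (q ^ t) ⟨
    fromℕ (⟦ suc t ⟧ q) ∎
    where
    hyp : Hyperplane K H (t +ℕ i)
    hyp = hyperplane sK rK fH
    fI′ : Flat S H i I
    fI′ = flat (sub fI) (rank fI) I⊆H
    meets : ∀ J → Flat S K (suc i) J → I ⊆ J → ¬ (J ⊆ H) → J ∩ H ≡ I
    meets J fJ I⊆J J⊈H = ≡.sym (equal-rank (sub fI) (rank fI) (rank f) (sub f)
                            (λ x∈I → x∈p∩q⁺ (I⊆J x∈I , I⊆H x∈I)))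
      where f = meet-flat-suc hyp fJ J⊈H

  count-over : IsSubspace S K → HasRank S K k → Flat S K i I →
               Σ (over? K (suc i) I) (λ _ → 1#) ≈ fromℕ (⟦ k ∸ i ⟧ q)
  count-over {k = k} {i = i} sK rK fI = count-over′ (k ∸ i) sK
    (≡.subst (HasRank S _) (≡.sym (ℕ.m∸n+n≡m (rank-mono (sub fI) (rank fI) rK (below fI)))) rK) fI

-- The case q = 1: subsets of a finite set.

∣U∪⁅p⁆∣ : ∀ {N} {U : Subset N} {p} → p ∉ U → ∣ U ∪ ⁅ p ⁆ ∣ ≡ suc ∣ U ∣
∣U∪⁅p⁆∣ {U = inside  ∷ U} {zero}  p∉U = contradiction here p∉U
∣U∪⁅p⁆∣ {U = outside ∷ U} {zero}  p∉U = ≡.cong (suc ∘ ∣_∣) (∪-identityʳ U)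
∣U∪⁅p⁆∣ {U = inside  ∷ U} {suc p} p∉U = ≡.cong suc (∣U∪⁅p⁆∣ (p∉U ∘ there))
∣U∪⁅p⁆∣ {U = outside ∷ U} {suc p} p∉U = ∣U∪⁅p⁆∣ (p∉U ∘ there)

finiteSetLaws : ∀ X fin → SubspaceLaws (finiteSet X fin)
finiteSetLaws X fin = record
  { _⊕_       = λ U p → U ∪ ⁅ p ⁆
  ; ⊕-sub     = λ _ → tt
  ; ⊆-⊕       = λ {U} {p} _ → p⊆p∪q ⁅ p ⁆
  ; ∈-⊕       = λ {U} {p} _ → q⊆p∪q U ⁅ p ⁆ (x∈⁅x⁆ p)
  ; ⊕-least   = λ {U} {p} {X} _ U⊆X p∈X {x} x∈ →
                  [ U⊆X , (λ x∈p → ≡.subst (_∈ X) (≡.sym (x∈⁅y⁆⇒x≡y p x∈p)) p∈X) ]′ (x∈p∪q⁻ U ⁅ p ⁆ x∈)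
  ; ⊕-modular = λ {H} {K} {p} {x} _ x∈ x∈K p∈K → x∈p∪q⁺
                  ([ (λ x∈H → inj₁ (x∈p∩q⁺ (x∈K , x∈H))) , inj₂ ]′ (x∈p∪q⁻ H ⁅ p ⁆ x∈))
  ; ⊕-rank    = λ _ r p∉U → ≡.trans (∣U∪⁅p⁆∣ p∉U) (≡.cong suc r)
  ; rank-mono = λ { _ ≡.refl ≡.refl K⊆U → p⊆q⇒∣p∣≤∣q∣ K⊆U }
  ; ∩-sub     = λ _ _ → tt
  ; ⊤-sub     = tt
  ; 𝟘         = ⊥
  ; 𝟘-sub     = tt
  ; 𝟘-rank    = ∣⊥∣≡0 (Finite.size fin)
  ; 𝟘-least   = λ _ → ⊥⊆
  ; 1≤q       = s≤s z≤n
  -- Over `G` the set `G ∪ {h}` has a single complement in `G ∪ {h, p}`, namely `G ∪ {p}`, so the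
  -- one point listed is `p`.
  ; pencil    = λ {G} {h} {p} _ h∉G p∉H →
      (λ _ → p)
    , (λ _ → q⊆p∪q (G ∪ ⁅ h ⁆) ⁅ p ⁆ (x∈⁅x⁆ p))
    , (λ _ → p∉H)
    , (λ { zero zero _ → ≡.refl })
    , (λ x x∈W x∉H → zero , [ (λ x∈H → contradiction x∈H x∉H)
                             , (λ x∈p → ≡.subst (λ y → p ∈ G ∪ ⁅ y ⁆) (≡.sym (x∈⁅y⁆⇒x≡y p x∈p))
                                          (q⊆p∪q G ⁅ p ⁆ (x∈⁅x⁆ p))) ]′ (x∈p∪q⁻ (G ∪ ⁅ h ⁆) ⁅ p ⁆ x∈W))
  }

-- The case q ≥ 2: linear subspaces over a finite field.

module _ {N : ℕ} {P : Fin N → Set} (P? : ∀ i → Dec (P i)) where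

  comprehension : Subset N
  comprehension = tabulate (does ∘ P?)

  ∈-comprehension⁺ : ∀ {i} → P i → i ∈ comprehension
  ∈-comprehension⁺ {i} p = Vec.lookup⇒[]= i comprehension
    (≡.trans (Vec.lookup∘tabulate (does ∘ P?) i) (dec-true (P? i) p))

  ∈-comprehension⁻ : ∀ {i} → i ∈ comprehension → P i
  ∈-comprehension⁻ {i} i∈ with P? i | ≡.trans (≡.sym (Vec.lookup∘tabulate (does ∘ P?) i)) (Vec.[]=⇒lookup i∈)
  ... | yes p | _ = p
  ... | no _  | ()

module LinearSubspaces (F : FiniteField) (M : Module (FiniteField.commutativeRing F) 0ℓ 0ℓ)
                       (fin : Finite (Module.≈ᴹ-setoid M)) where
  open FiniteField F hiding (zero)
  open FieldProperties field′
  open Module M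
  open Finite fin using (size; index; element; index-cong; strictlyInverseˡ; strictlyInverseʳ)
  open LinearAlgebra F M fin
  open IsLinearSubspace
  open CommutativeSemigroupProperties (CommutativeMonoid.commutativeSemigroup +ᴹ-commutativeMonoid)
    using (interchange)
  open GroupProperties +-group using (x∙y⁻¹≈ε⇒x≈y; inverseʳ-unique)
  open SetoidReasoning ≈ᴹ-setoid
  private
    module Fⁱ = Finite finite

  ∈-resp : ∀ {U u v} → u ≈ᴹ v → u ∈ᴹ U → v ∈ᴹ U
  ∈-resp {U} eq = ≡.subst (_∈ U) (index-cong eq)

  point : ∀ {U i} → i ∈ U → element i ∈ᴹ U
  point {U} {i} = ≡.subst (_∈ U) (≡.sym (strictlyInverseˡ i))

  unpoint : ∀ {U i} → element i ∈ᴹ U → i ∈ U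
  unpoint {U} {i} = ≡.subst (_∈ U) (strictlyInverseˡ i)

  -- A vector lies in U + span p when some translate of it along p falls into U. In this form only
  -- the scalars have to be searched; the price is a change of sign when the vector is recovered.
  meetsTranslates? : ∀ U p i → Dec (∃[ c ] (element i +ᴹ c *ₗ element p) ∈ᴹ U)
  meetsTranslates? U p i = Fⁱ.any? (λ eq → ∈-resp (+ᴹ-congˡ (*ₗ-congʳ eq)))
                                   (λ c → index (element i +ᴹ c *ₗ element p) ∈? U)

  infixl 6 _⊕ᴹ_
  _⊕ᴹ_ : Subset size → Fin size → Subset size
  U ⊕ᴹ p = comprehension (meetsTranslates? U p)

  ∈-⊕ᴹ⁺ : ∀ {U p v} c → (v +ᴹ c *ₗ element p) ∈ᴹ U → v ∈ᴹ (U ⊕ᴹ p)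
  ∈-⊕ᴹ⁺ {U} {p} {v} c m =
    ∈-comprehension⁺ (meetsTranslates? U p) (c , ∈-resp (+ᴹ-congʳ (≈ᴹ-sym (strictlyInverseʳ v))) m)

  ∈-⊕ᴹ⁻ : ∀ {U p v} → v ∈ᴹ (U ⊕ᴹ p) → ∃[ c ] (v +ᴹ c *ₗ element p) ∈ᴹ U
  ∈-⊕ᴹ⁻ {U} {p} {v} m =
    let c , m′ = ∈-comprehension⁻ (meetsTranslates? U p) m in c , ∈-resp (+ᴹ-congʳ (strictlyInverseʳ v)) m′

  module _ {U} (sU : IsLinearSubspace U) where

    *-closed⁻¹ : ∀ {c u} → ¬ (c ≈ 0#) → (c *ₗ u) ∈ᴹ U → u ∈ᴹ U
    *-closed⁻¹ {c} {u} c≉0 m = ∈-resp eq (*ₗ-closed sU (c ⁻¹) _ m)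
      where
      eq : c ⁻¹ *ₗ (c *ₗ u) ≈ᴹ u
      eq = begin
        c ⁻¹ *ₗ (c *ₗ u)  ≈⟨ *ₗ-assoc _ _ _ ⟨
        (c ⁻¹ * c) *ₗ u   ≈⟨ *ₗ-congʳ (*-inverseˡ c c≉0) ⟩
        1# *ₗ u           ≈⟨ *ₗ-identityˡ u ⟩
        u                 ∎

    combination-closed : ∀ {d} (c : Vector Carrier d) b → (∀ i → b i ∈ᴹ U) → combination c b ∈ᴹ U
    combination-closed {zero}  c b m = 0ᴹ-closed sU
    combination-closed {suc d} c b m = +ᴹ-closed sU _ _ (*ₗ-closed sU _ _ (m zero))
      (combination-closed (c ∘ suc) (b ∘ suc) (m ∘ suc))

  cancel-multiple : ∀ v c u → (v +ᴹ c *ₗ u) +ᴹ (- c) *ₗ u ≈ᴹ v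
  cancel-multiple v c u = begin
    (v +ᴹ c *ₗ u) +ᴹ (- c) *ₗ u  ≈⟨ +ᴹ-assoc _ _ _ ⟩
    v +ᴹ (c *ₗ u +ᴹ (- c) *ₗ u)  ≈⟨ +ᴹ-congˡ (*ₗ-distribʳ _ _ _) ⟨
    v +ᴹ (c + - c) *ₗ u          ≈⟨ +ᴹ-congˡ (≈ᴹ-trans (*ₗ-congʳ (-‿inverseʳ c)) (*ₗ-zeroˡ u)) ⟩
    v +ᴹ 0ᴹ                      ≈⟨ +ᴹ-identityʳ v ⟩
    v                            ∎

  ⊆-⊕ᴹ : ∀ {U p} → U ⊆ U ⊕ᴹ p
  ⊆-⊕ᴹ {U} {p} {i} i∈U = unpoint (∈-⊕ᴹ⁺ 0# (∈-resp (≈ᴹ-sym eq) (point i∈U)))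
    where
    eq : element i +ᴹ 0# *ₗ element p ≈ᴹ element i
    eq = ≈ᴹ-trans (+ᴹ-congˡ (*ₗ-zeroˡ _)) (+ᴹ-identityʳ _)

  ∈-⊕ᴹ : ∀ {U p} → IsLinearSubspace U → p ∈ U ⊕ᴹ p
  ∈-⊕ᴹ {U} {p} sU = unpoint (∈-⊕ᴹ⁺ (- 1#) (∈-resp (≈ᴹ-sym eq) (0ᴹ-closed sU)))
    where
    eq : element p +ᴹ (- 1#) *ₗ element p ≈ᴹ 0ᴹ
    eq = begin
      element p +ᴹ (- 1#) *ₗ element p       ≈⟨ +ᴹ-congʳ (*ₗ-identityˡ _) ⟨
      1# *ₗ element p +ᴹ (- 1#) *ₗ element p ≈⟨ *ₗ-distribʳ _ _ _ ⟨
      (1# + - 1#) *ₗ element p              ≈⟨ *ₗ-congʳ (-‿inverseʳ 1#) ⟩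
      0# *ₗ element p                       ≈⟨ *ₗ-zeroˡ _ ⟩
      0ᴹ                                    ∎

  ⊕ᴹ-least : ∀ {U p X} → IsLinearSubspace X → U ⊆ X → p ∈ X → U ⊕ᴹ p ⊆ X
  ⊕ᴹ-least {U} {p} {X} sX U⊆X p∈X {i} i∈ = let c , m = ∈-⊕ᴹ⁻ (point i∈) in
    unpoint (∈-resp (cancel-multiple (element i) c (element p))
      (+ᴹ-closed sX _ _ (U⊆X m) (*ₗ-closed sX (- c) _ (point p∈X))))

  ⊕ᴹ-modular : ∀ {H K p x} → IsLinearSubspace K → x ∈ H ⊕ᴹ p → x ∈ K → p ∈ K → x ∈ (K ∩ H) ⊕ᴹ p
  ⊕ᴹ-modular sK x∈ x∈K p∈K = let c , m = ∈-⊕ᴹ⁻ (point x∈) in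
    unpoint (∈-⊕ᴹ⁺ c (x∈p∩q⁺ (+ᴹ-closed sK _ _ (point x∈K) (*ₗ-closed sK c _ (point p∈K)) , m)))

  ⊕ᴹ-sub : ∀ {U p} → IsLinearSubspace U → IsLinearSubspace (U ⊕ᴹ p)
  ⊕ᴹ-sub {U} {p} sU = record
    { 0ᴹ-closed = ⊆-⊕ᴹ (0ᴹ-closed sU)
    ; +ᴹ-closed = λ u v u∈ v∈ → let c , m = ∈-⊕ᴹ⁻ u∈ ; d , m′ = ∈-⊕ᴹ⁻ v∈ in
        ∈-⊕ᴹ⁺ (c + d) (∈-resp
          (≈ᴹ-trans (interchange _ _ _ _) (+ᴹ-congˡ (≈ᴹ-sym (*ₗ-distribʳ _ _ _))))
          (+ᴹ-closed sU _ _ m m′))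
    ; *ₗ-closed = λ a u u∈ → let c , m = ∈-⊕ᴹ⁻ u∈ in
        ∈-⊕ᴹ⁺ (a * c) (∈-resp
          (≈ᴹ-trans (*ₗ-distribˡ _ _ _) (+ᴹ-congˡ (≈ᴹ-sym (*ₗ-assoc _ _ _))))
          (*ₗ-closed sU a _ m))
    }

  -- In a relation the coefficient of the new vector must vanish, as otherwise `*-closed⁻¹` would
  -- put `p` into `U`. In `spanning` that coefficient is `- c` because `u + c p` is what lies in
  -- `U`.
  ⊕ᴹ-rank : ∀ {U p d} → IsLinearSubspace U → HasDimension U d → p ∉ U → HasDimension (U ⊕ᴹ p) (suc d)
  ⊕ᴹ-rank {U} {p} {d} sU (b , basis) p∉U = b′ , record
    { members     = λ { zero → point (∈-⊕ᴹ sU) ; (suc i) → ⊆-⊕ᴹ (members i) }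
    ; independent = independent′
    ; spanning    = λ u u∈ → let c , m = ∈-⊕ᴹ⁻ u∈ ; a , eq = spanning _ m in
        (λ { zero → - c ; (suc i) → a i })
        , ≈ᴹ-trans (+ᴹ-comm _ _) (≈ᴹ-trans (+ᴹ-congʳ eq) (cancel-multiple u c (element p)))
    }
    where
    open IsBasis basis
    b′ : Vector Carrierᴹ (suc d)
    b′ zero    = element p
    b′ (suc i) = b i

    independent′ : ∀ c → combination c b′ ≈ᴹ 0ᴹ → ∀ i → c i ≈ 0#
    independent′ c eq = vanish
      where
      rest = combination (c ∘ suc) b
      head≈0 : c zero ≈ 0#
      head≈0 with c zero Fⁱ.≈? 0#
      ... | yes p = p
      ... | no c≉0 = contradiction (unpoint (*-closed⁻¹ sU c≉0 (∈-resp
              (≈ᴹ-sym (GroupProperties.inverseˡ-unique +ᴹ-group _ _ eq))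
              (∈-resp minus (*ₗ-closed sU (- 1#) _ (combination-closed sU (c ∘ suc) b members)))))) p∉U
        where
        minus : (- 1#) *ₗ rest ≈ᴹ -ᴹ rest
        minus = GroupProperties.inverseʳ-unique +ᴹ-group _ _ (begin
          rest +ᴹ (- 1#) *ₗ rest        ≈⟨ +ᴹ-congʳ (*ₗ-identityˡ _) ⟨
          1# *ₗ rest +ᴹ (- 1#) *ₗ rest  ≈⟨ *ₗ-distribʳ _ _ _ ⟨
          (1# + - 1#) *ₗ rest           ≈⟨ *ₗ-congʳ (-‿inverseʳ 1#) ⟩
          0# *ₗ rest                    ≈⟨ *ₗ-zeroˡ _ ⟩
          0ᴹ                            ∎)
      vanish : ∀ i → c i ≈ 0#
      vanish zero    = head≈0
      vanish (suc i) = independent (c ∘ suc) (begin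
        rest                          ≈⟨ +ᴹ-identityˡ _ ⟨
        0ᴹ +ᴹ rest                    ≈⟨ +ᴹ-congʳ (≈ᴹ-trans (*ₗ-congʳ head≈0) (*ₗ-zeroˡ _)) ⟨
        c zero *ₗ element p +ᴹ rest   ≈⟨ eq ⟩
        0ᴹ                            ∎) i

  combination-cong : ∀ {d} {c c′ : Vector Carrier d} b → (∀ i → c i ≈ c′ i) →
                     combination c b ≈ᴹ combination c′ b
  combination-cong {zero}  b eq = ≈ᴹ-refl
  combination-cong {suc d} b eq = +ᴹ-cong (*ₗ-congʳ (eq zero)) (combination-cong (b ∘ suc) (eq ∘ suc))

  combination-+ : ∀ {d} (c c′ : Vector Carrier d) b →
                  combination (λ i → c i + c′ i) b ≈ᴹ combination c b +ᴹ combination c′ b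
  combination-+ {zero}  c c′ b = ≈ᴹ-sym (+ᴹ-identityʳ 0ᴹ)
  combination-+ {suc d} c c′ b = ≈ᴹ-trans
    (+ᴹ-cong (*ₗ-distribʳ _ _ _) (combination-+ (c ∘ suc) (c′ ∘ suc) (b ∘ suc)))
    (interchange _ _ _ _)

  combination-0 : ∀ {d} {c : Vector Carrier d} b → (∀ i → c i ≈ 0#) → combination c b ≈ᴹ 0ᴹ
  combination-0 {zero}  b eq = ≈ᴹ-refl
  combination-0 {suc d} b eq = ≈ᴹ-trans
    (+ᴹ-cong (≈ᴹ-trans (*ₗ-congʳ (eq zero)) (*ₗ-zeroˡ _)) (combination-0 (b ∘ suc) (eq ∘ suc)))
    (+ᴹ-identityʳ 0ᴹ)

  combination-injective : ∀ {U d b} → IsBasis U {d} b →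
                          ∀ c c′ → combination c b ≈ᴹ combination c′ b → ∀ i → c i ≈ c′ i
  combination-injective {b = b} basis c c′ eq i = x∙y⁻¹≈ε⇒x≈y _ _
    (IsBasis.independent basis (λ i → c i + - c′ i) (begin
      combination (λ i → c i + - c′ i) b                     ≈⟨ combination-+ c (λ i → - c′ i) b ⟩
      combination c b +ᴹ combination (λ i → - c′ i) b        ≈⟨ +ᴹ-congʳ eq ⟩
      combination c′ b +ᴹ combination (λ i → - c′ i) b       ≈⟨ combination-+ c′ (λ i → - c′ i) b ⟨
      combination (λ i → c′ i + - c′ i) b                    ≈⟨ combination-0 b (λ i → -‿inverseʳ (c′ i)) ⟩
      0ᴹ                                                     ∎) i)

  2≤order : 2 ≤ order
  2≤order = Fin.injective⇒≤ {f = f} injective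
    where
    f : Fin 2 → Fin order
    f zero    = Fⁱ.index 0#
    f (suc _) = Fⁱ.index 1#
    index-injective : ∀ {x y} → Fⁱ.index x ≡ Fⁱ.index y → x ≈ y
    index-injective {x} {y} eq =
      trans (sym (Fⁱ.strictlyInverseʳ x)) (trans (Fⁱ.from-cong eq) (Fⁱ.strictlyInverseʳ y))
    injective : ∀ {i j} → f i ≡ f j → i ≡ j
    injective {zero}     {zero}     _  = ≡.refl
    injective {zero}     {suc zero} eq = contradiction (index-injective eq) 0≉1
    injective {suc zero} {zero}     eq = contradiction (sym (index-injective eq)) 0≉1
    injective {suc zero} {suc zero} _  = ≡.refl

  -- Sending a combination of a basis of K to its coordinates in U injects F^k into F^d.
  dimension-mono : ∀ {K U k d} → IsLinearSubspace K → HasDimension K k → HasDimension U d → K ⊆ U → k ≤ d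
  dimension-mono {K} {U} {k} {d} sK (b , basis) (b′ , basis′) K⊆U = ℕ.≮⇒≥ λ d<k →
    ℕ.<⇒≱ (ℕ.^-monoʳ-< order 2≤order d<k) (Fin.injective⇒≤ {f = coordinates} injective)
    where
    module Fᵏ = Finite (vectors finite k)
    module Fᵈ = Finite (vectors finite d)
    coord : ∀ i → ∃[ a ] combination a b′ ≈ᴹ combination (Fᵏ.element i) b
    coord i = IsBasis.spanning basis′ _ (K⊆U (combination-closed sK (Fᵏ.element i) b (IsBasis.members basis)))
    coordinates : Fin (order ^ k) → Fin (order ^ d)
    coordinates i = Fᵈ.index (proj₁ (coord i))
    injective : ∀ {i j} → coordinates i ≡ coordinates j → i ≡ j
    injective {i} {j} eq =
      ≡.trans (≡.sym (Fᵏ.strictlyInverseˡ i)) (≡.trans (Fᵏ.index-cong c≈c′) (Fᵏ.strictlyInverseˡ j))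
      where
      a≈a′ : ∀ l → proj₁ (coord i) l ≈ proj₁ (coord j) l
      a≈a′ l = trans (sym (Fᵈ.strictlyInverseʳ (proj₁ (coord i)) l))
               (trans (Fᵈ.from-cong eq l) (Fᵈ.strictlyInverseʳ (proj₁ (coord j)) l))
      c≈c′ : ∀ l → Fᵏ.element i l ≈ Fᵏ.element j l
      c≈c′ = combination-injective basis (Fᵏ.element i) (Fᵏ.element j) (begin
        combination (Fᵏ.element i) b     ≈⟨ proj₂ (coord i) ⟨
        combination (proj₁ (coord i)) b′ ≈⟨ combination-cong b′ a≈a′ ⟩
        combination (proj₁ (coord j)) b′ ≈⟨ proj₂ (coord j) ⟩
        combination (Fᵏ.element j) b     ∎)

  ∩-subᴹ : ∀ {U V} → IsLinearSubspace U → IsLinearSubspace V → IsLinearSubspace (U ∩ V)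
  ∩-subᴹ {U} {V} sU sV = record
    { 0ᴹ-closed = x∈p∩q⁺ (0ᴹ-closed sU , 0ᴹ-closed sV)
    ; +ᴹ-closed = λ u v u∈ v∈ → let u∈U , u∈V = x∈p∩q⁻ U V u∈ ; v∈U , v∈V = x∈p∩q⁻ U V v∈ in
        x∈p∩q⁺ (+ᴹ-closed sU u v u∈U v∈U , +ᴹ-closed sV u v u∈V v∈V)
    ; *ₗ-closed = λ c u u∈ → let u∈U , u∈V = x∈p∩q⁻ U V u∈ in
        x∈p∩q⁺ (*ₗ-closed sU c u u∈U , *ₗ-closed sV c u u∈V)
    }

  𝟘ᴹ : Subset size
  𝟘ᴹ = ⁅ index 0ᴹ ⁆

  ∈-𝟘ᴹ⁺ : ∀ {u} → u ≈ᴹ 0ᴹ → u ∈ᴹ 𝟘ᴹ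
  ∈-𝟘ᴹ⁺ eq = ∈-resp (≈ᴹ-sym eq) (x∈⁅x⁆ _)

  ∈-𝟘ᴹ⁻ : ∀ {u} → u ∈ᴹ 𝟘ᴹ → u ≈ᴹ 0ᴹ
  ∈-𝟘ᴹ⁻ {u} m = ≈ᴹ-trans (≈ᴹ-sym (strictlyInverseʳ u))
    (≈ᴹ-trans (Finite.from-cong fin (x∈⁅y⁆⇒x≡y _ m)) (strictlyInverseʳ 0ᴹ))

  𝟘ᴹ-sub : IsLinearSubspace 𝟘ᴹ
  𝟘ᴹ-sub = record
    { 0ᴹ-closed = x∈⁅x⁆ _
    ; +ᴹ-closed = λ u v u∈ v∈ → ∈-𝟘ᴹ⁺ (≈ᴹ-trans (+ᴹ-cong (∈-𝟘ᴹ⁻ u∈) (∈-𝟘ᴹ⁻ v∈)) (+ᴹ-identityʳ 0ᴹ))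
    ; *ₗ-closed = λ c u u∈ → ∈-𝟘ᴹ⁺ (≈ᴹ-trans (*ₗ-congˡ (∈-𝟘ᴹ⁻ u∈)) (*ₗ-zeroʳ c))
    }

  𝟘ᴹ-rank : HasDimension 𝟘ᴹ 0
  𝟘ᴹ-rank = (λ ()) , record
    { members     = λ ()
    ; independent = λ _ _ ()
    ; spanning    = λ u u∈ → (λ ()) , ≈ᴹ-sym (∈-𝟘ᴹ⁻ u∈)
    }

  -- The complements of G ⊕ h over G in (G ⊕ h) ⊕ p are the spans of G and p + c h.
  pencilᴹ : ∀ {G h p} → IsLinearSubspace G → h ∉ G → p ∉ G ⊕ᴹ h →
            Σ[ κ ∈ (Fin order → Fin size) ]
              (∀ c → κ c ∈ (G ⊕ᴹ h) ⊕ᴹ p)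
            × (∀ c → κ c ∉ G ⊕ᴹ h)
            × (∀ c c′ → κ c ∈ G ⊕ᴹ κ c′ → c ≡ c′)
            × (∀ x → x ∈ (G ⊕ᴹ h) ⊕ᴹ p → x ∉ G ⊕ᴹ h → ∃[ c ] κ c ∈ G ⊕ᴹ x)
  pencilᴹ {G} {h} {p} sG h∉G p∉H = (λ c → index (k c)) , κ∈W , κ∉H , κ-injective , κ-surjective
    where
    sH = ⊕ᴹ-sub {p = h} sG
    hᴹ = element h
    pᴹ = element p
    k : Fin order → Carrierᴹ
    k c = pᴹ +ᴹ Fⁱ.element c *ₗ hᴹ
    hᴹ∈H : hᴹ ∈ᴹ (G ⊕ᴹ h)
    hᴹ∈H = point (∈-⊕ᴹ sG)

    κ∈W : ∀ c → k c ∈ᴹ ((G ⊕ᴹ h) ⊕ᴹ p)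
    κ∈W c = +ᴹ-closed sW _ _ (point (∈-⊕ᴹ sH)) (*ₗ-closed sW _ _ (⊆-⊕ᴹ hᴹ∈H))
      where sW = ⊕ᴹ-sub {p = p} sH

    κ∉H : ∀ c → ¬ (k c ∈ᴹ (G ⊕ᴹ h))
    κ∉H c m = p∉H (unpoint (∈-resp (cancel-multiple pᴹ (Fⁱ.element c) hᴹ)
                (+ᴹ-closed sH _ _ m (*ₗ-closed sH _ _ hᴹ∈H))))

    κ-injective : ∀ c c′ → k c ∈ᴹ (G ⊕ᴹ index (k c′)) → c ≡ c′
    κ-injective c c′ m =
      ≡.trans (≡.sym (Fⁱ.strictlyInverseˡ c)) (≡.trans (Fⁱ.index-cong a≈a′) (Fⁱ.strictlyInverseˡ c′))
      where
      a  = Fⁱ.element c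
      a′ = Fⁱ.element c′
      d  = proj₁ (∈-⊕ᴹ⁻ m)
      -- The coefficient of p vanishes since p is off `G ⊕ᴹ h`, then that of h since h is off `G`.
      -- Hence d = -1 and a = a′.
      m′ : ((1# + d) *ₗ pᴹ +ᴹ (a + d * a′) *ₗ hᴹ) ∈ᴹ G
      m′ = ∈-resp (begin
        k c +ᴹ d *ₗ element (index (k c′))
          ≈⟨ +ᴹ-congˡ (*ₗ-congˡ (strictlyInverseʳ (k c′))) ⟩
        k c +ᴹ d *ₗ k c′
          ≈⟨ +ᴹ-congˡ (*ₗ-distribˡ _ _ _) ⟩
        k c +ᴹ (d *ₗ pᴹ +ᴹ d *ₗ (a′ *ₗ hᴹ))
          ≈⟨ interchange _ _ _ _ ⟩
        (pᴹ +ᴹ d *ₗ pᴹ) +ᴹ (a *ₗ hᴹ +ᴹ d *ₗ (a′ *ₗ hᴹ))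
          ≈⟨ +ᴹ-cong (+ᴹ-congʳ (*ₗ-identityˡ _)) (+ᴹ-congˡ (*ₗ-assoc _ _ _)) ⟨
        (1# *ₗ pᴹ +ᴹ d *ₗ pᴹ) +ᴹ (a *ₗ hᴹ +ᴹ (d * a′) *ₗ hᴹ)
          ≈⟨ +ᴹ-cong (*ₗ-distribʳ _ _ _) (*ₗ-distribʳ _ _ _) ⟨
        (1# + d) *ₗ pᴹ +ᴹ (a + d * a′) *ₗ hᴹ ∎) (proj₂ (∈-⊕ᴹ⁻ m))
      1+d≈0 : 1# + d ≈ 0#
      1+d≈0 with (1# + d) Fⁱ.≈? 0#
      ... | yes eq = eq
      ... | no  ≉0 = contradiction (unpoint (*-closed⁻¹ sH ≉0 (∈-⊕ᴹ⁺ (a + d * a′) m′))) p∉H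
      m″ : ((a + d * a′) *ₗ hᴹ) ∈ᴹ G
      m″ = ∈-resp (≈ᴹ-trans (+ᴹ-congʳ (≈ᴹ-trans (*ₗ-congʳ 1+d≈0) (*ₗ-zeroˡ _))) (+ᴹ-identityˡ _)) m′
      a+da′≈0 : a + d * a′ ≈ 0#
      a+da′≈0 with (a + d * a′) Fⁱ.≈? 0#
      ... | yes eq = eq
      ... | no  ≉0 = contradiction (unpoint (*-closed⁻¹ sG ≉0 m″)) h∉G
      a≈a′ : a ≈ a′
      a≈a′ = x∙y⁻¹≈ε⇒x≈y a a′ (trans (+-congˡ (trans (-‿cong (sym (*-identityˡ a′)))
               (trans (-‿distribˡ-* _ _) (*-congʳ (sym (inverseʳ-unique _ _ 1+d≈0)))))) a+da′≈0)

    κ-surjective : ∀ x → x ∈ (G ⊕ᴹ h) ⊕ᴹ p → x ∉ G ⊕ᴹ h → ∃[ c ] k c ∈ᴹ (G ⊕ᴹ x)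
    κ-surjective x x∈W x∉H with ∈-⊕ᴹ⁻ (point x∈W)
    ... | d , m with ∈-⊕ᴹ⁻ m | d Fⁱ.≈? 0#
    ...   | _ | yes d≈0 = contradiction (unpoint (∈-resp
              (≈ᴹ-trans (+ᴹ-congˡ (≈ᴹ-trans (*ₗ-congʳ d≈0) (*ₗ-zeroˡ _))) (+ᴹ-identityʳ _)) m)) x∉H
    -- Here x + d p + e h lies in `G`; dividing by d shows that p + (e / d) h lies in `G ⊕ᴹ x`.
    ...   | e , m′ | no d≉0 = Fⁱ.index a , ∈-⊕ᴹ⁺ (d ⁻¹) (∈-resp (begin
      d ⁻¹ *ₗ (element x +ᴹ d *ₗ pᴹ +ᴹ e *ₗ hᴹ)
        ≈⟨ *ₗ-distribˡ _ _ _ ⟩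
      d ⁻¹ *ₗ (element x +ᴹ d *ₗ pᴹ) +ᴹ d ⁻¹ *ₗ (e *ₗ hᴹ)
        ≈⟨ +ᴹ-cong (*ₗ-distribˡ _ _ _) (≈ᴹ-sym (*ₗ-assoc _ _ _)) ⟩
      d ⁻¹ *ₗ element x +ᴹ d ⁻¹ *ₗ (d *ₗ pᴹ) +ᴹ a *ₗ hᴹ
        ≈⟨ +ᴹ-cong (+ᴹ-congˡ (≈ᴹ-trans (≈ᴹ-sym (*ₗ-assoc _ _ _))
             (≈ᴹ-trans (*ₗ-congʳ (*-inverseˡ d d≉0)) (*ₗ-identityˡ _))))
             (*ₗ-congʳ (sym (Fⁱ.strictlyInverseʳ a))) ⟩
      d ⁻¹ *ₗ element x +ᴹ pᴹ +ᴹ Fⁱ.element (Fⁱ.index a) *ₗ hᴹ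
        ≈⟨ +ᴹ-assoc _ _ _ ⟩
      d ⁻¹ *ₗ element x +ᴹ k (Fⁱ.index a)
        ≈⟨ +ᴹ-comm _ _ ⟩
      k (Fⁱ.index a) +ᴹ d ⁻¹ *ₗ element x ∎) (*ₗ-closed sG (d ⁻¹) _ m′))
      where a = d ⁻¹ * e

  vectorSpaceLaws : SubspaceLaws (vectorSpace F M fin)
  vectorSpaceLaws = record
    { _⊕_       = _⊕ᴹ_
    ; ⊕-sub     = ⊕ᴹ-sub
    ; ⊆-⊕       = λ _ → ⊆-⊕ᴹ
    ; ∈-⊕       = ∈-⊕ᴹ
    ; ⊕-least   = ⊕ᴹ-least
    ; ⊕-modular = ⊕ᴹ-modular
    ; ⊕-rank    = ⊕ᴹ-rank
    ; rank-mono = dimension-mono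
    ; ∩-sub     = ∩-subᴹ
    ; ⊤-sub     = record { 0ᴹ-closed = ∈⊤ ; +ᴹ-closed = λ _ _ _ _ → ∈⊤ ; *ₗ-closed = λ _ _ _ → ∈⊤ }
    ; 𝟘         = 𝟘ᴹ
    ; 𝟘-sub     = 𝟘ᴹ-sub
    ; 𝟘-rank    = 𝟘ᴹ-rank
    ; 𝟘-least   = λ {U} sU x∈ → ≡.subst (_∈ U) (≡.sym (x∈⁅y⁆⇒x≡y _ x∈)) (0ᴹ-closed sU)
    ; 1≤q       = ℕ.<⇒≤ 2≤order
    ; pencil    = pencilᴹ
    }

subspaceLaws : ∀ S → SubspaceLaws S
subspaceLaws (finiteSet X fin)     = finiteSetLaws X fin
subspaceLaws (vectorSpace F V fin) = LinearSubspaces.vectorSpaceLaws F V fin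

⟦⟧-pos : ∀ {q} m → 1 ≤ q → 0 < m → 0 < ⟦ m ⟧ q
⟦⟧-pos {suc q} (suc m) _ _ = ℕ.≤-trans (ℕ.m^n>0 (suc q) m) (ℕ.m≤n+m _ (⟦ m ⟧ suc q))

-- Inclusion transforms, their injectivity and the drop of degree.

module Transforms (ℝ : RealNumbers) (S : Space) (laws : SubspaceLaws S) {n : ℕ} (⊤-rank : HasRank S ⊤ n) where
  open RealNumbers ℝ hiding (_≤_; zero)
  open RealProperties ℝ
  open SubsetSums ℝ
  open Geometry S laws ⊤-rank
  open Counting ℝ S laws ⊤-rank
  open Flat
  open SetoidReasoning setoid

  private
    q = baseOrder S
    variable
      H I K L U W : Subset (card S)
      i j k ℓ m : ℕ

  ⟦⟧-≉0 : j < k → ¬ (fromℕ (⟦ k ∸ j ⟧ q) ≈ 0#)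
  ⟦⟧-≉0 j<k = fromℕ-≉0 (⟦⟧-pos _ 1≤q (ℕ.m<n⇒0<n∸m j<k))

  q^-≉0 : ∀ t → ¬ (fromℕ (q ^ t) ≈ 0#)
  q^-≉0 t = fromℕ-≉0 (ℕ.m^n>0 q {{>-nonZero 1≤q}} t)

  -- The inclusion matrix of rank i, also known as a Radon transform. Its argument and value are
  -- functions on all subsets, so transforms compose and are evaluated in any rank without
  -- conversions.
  T : ℕ → (Subset (card S) → Carrier) → Subset (card S) → Carrier
  T i w K = Σ (flat? S K i) w

  T-* : ∀ i c w K → T i (λ I → c * w I) K ≈ c * T i w K
  T-* i c w K = Σ-* (flat? S K i) c w

  T-self : IsSubspace S K → HasRank S K k → ∀ w → T k w K ≈ w K
  T-self {K} {k} sK rK w = Σ-single (flat? S K k) w (flat-self sK rK)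
    (λ U (flat sU rU U⊆K) → equal-rank sU rU rK sK U⊆K)

  T-zero : IsSubspace S I → HasRank S I 0 → Flat S W k K → ∀ w → I ⊆ K → T 0 w K ≈ w I
  T-zero {I} {W} {k} {K} sI rI fK w I⊆K = Σ-single (flat? S K 0) w (flat sI rI I⊆K)
    (λ U f → ≡.trans (≡.sym (bottom (sub f) (rank f))) (bottom sI rI))
    where
    bottom : ∀ {U} → IsSubspace S U → HasRank S U 0 → 𝟘 ≡ U
    bottom sU rU = equal-rank 𝟘-sub 𝟘-rank rU sU (𝟘-least sU)

  -- Each `I ≤ K` of rank i lies below [k-i] flats of rank i + 1 inside `K`.
  T-∘ : IsSubspace S K → HasRank S K k → ∀ i w → T (suc i) (T i w) K ≈ fromℕ (⟦ k ∸ i ⟧ q) * T i w K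
  T-∘ {K} {k} sK rK i w = begin
    Σ (flat? S K (suc i)) (λ J → Σ (flat? S J i) w)
      ≈⟨ Σ-swap (flat? S K (suc i)) (λ J → flat? S J i) (flat? S K i) (over? K (suc i)) (λ _ I → w I)
           (λ J I (fJ , fI) → flat-⊆ (below fJ) fI , fJ , below fI)
           (λ J I (fI , fJ , I⊆J) → fJ , flat (sub fI) (rank fI) I⊆J) ⟩
    Σ (flat? S K i) (λ I → Σ (over? K (suc i) I) (λ _ → w I))
      ≈⟨ Σ-congˡ (flat? S K i) (λ I fI →
           trans (Σ-const (over? K (suc i) I) (w I))
                 (trans (*-congˡ (count-over sK rK fI)) (*-comm _ _))) ⟩
    Σ (flat? S K i) (λ I → fromℕ (⟦ k ∸ i ⟧ q) * w I)
      ≈⟨ T-* i _ w K ⟩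
    fromℕ (⟦ k ∸ i ⟧ q) * T i w K ∎

  -- The weights obtained from w by pushing each flat off H down to its trace on H.
  trace : (W H : Subset (card S)) → ℕ → (Subset (card S) → Carrier) → Subset (card S) → Carrier
  trace W H j w J = Σ (above? W H J j) w

  -- Every flat `I` off `H` has exactly one trace, so grouping by `J = I ∩ H` loses nothing. This
  -- identifies the contribution of these flats to the double count.
  T-trace : Hyperplane W H m → Flat S H ℓ L → ∀ j w →
            T j (trace W H j w) L ≈
            Σ (λ I → (flat? S W (suc j) I ×-dec ((I ∩ H) ⊆? L)) ×-dec ¬? (I ⊆? H)) w
  T-trace {W} {H} {m} {ℓ} {L} hyp fL j w = begin
    Σ (flat? S L j) (λ J → Σ (above? W H J j) w)
      ≈⟨ Σ-swap (flat? S L j) (λ J → above? W H J j) off? (λ I J → J ≟ˢ (I ∩ H)) (λ _ I → w I)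
           (λ J I (fJ , a@(fI , I∩H≡J)) →
             ((fI , ⊆-trans (⊆-reflexive I∩H≡J) (below fJ)) , above-⊈ (flat-⊆ (below fL) fJ) a) , ≡.sym I∩H≡J)
           (λ { J I (((fI , I∩H⊆L) , I⊈H) , ≡.refl) →
             let f = meet-flat-suc hyp fI I⊈H in flat (sub f) (rank f) I∩H⊆L , fI , ≡.refl }) ⟩
    Σ off? (λ I → Σ (λ J → J ≟ˢ (I ∩ H)) (λ _ → w I))
      ≈⟨ Σ-congˡ off? (λ I _ → Σ-single (λ J → J ≟ˢ (I ∩ H)) {I ∩ H} (λ _ → w I) ≡.refl (λ _ → id)) ⟩
    Σ off? w ∎
    where
    off? = λ I → (flat? S W (suc j) I ×-dec ((I ∩ H) ⊆? L)) ×-dec ¬? (I ⊆? H)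

  -- Double counting of the pairs I ≤ K with K ∩ H = L: a given I ≤ H lies in q^(m-ℓ) such K
  -- if I ≤ L, and a given I ≰ H lies in exactly one if I ∩ H ≤ L.
  sum-above : Hyperplane W H m → Flat S H ℓ L → ∀ j w →
              Σ (above? W H L ℓ) (T (suc j) w) ≈
              fromℕ (q ^ (m ∸ ℓ)) * T (suc j) w L + T j (trace W H j w) L
  sum-above {W} {H} {m} {ℓ} {L} hyp fL j w = begin
    Σ (above? W H L ℓ) (λ K → Σ (flat? S K (suc j)) w)
      ≈⟨ Σ-swap (above? W H L ℓ) (λ K → flat? S K (suc j)) near? through? (λ _ I → w I)
           (λ K I (a@(fK , K∩H≡L) , fI) → (flat-⊆ (below fK) fI
             , λ {x} x∈ → let x∈I , x∈H = x∈p∩q⁻ I H x∈ in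
                          ≡.subst (x ∈_) K∩H≡L (x∈p∩q⁺ (below fI x∈I , x∈H)))
             , a , below fI)
           (λ K I ((fI , _) , a , I⊆K) → a , flat (sub fI) (rank fI) I⊆K) ⟩
    Σ near? (λ I → Σ (through? I) (λ _ → w I))
      ≈⟨ Σ-split near? (_⊆? H) _ ⟩
    Σ on? (λ I → Σ (through? I) (λ _ → w I)) + Σ off? (λ I → Σ (through? I) (λ _ → w I))
      ≈⟨ +-cong
           (Σ-cong on? (flat? S L (suc j))
             (λ I ((fI , I∩H⊆L) , I⊆H) → flat (sub fI) (rank fI) (⊆-trans (∩-absorb I⊆H) I∩H⊆L))
             (λ I fI → (flat-⊆ (⊆-trans (below fL) (below (isFlat hyp))) fI , ⊆-trans (p∩q⊆p I H) (below fI))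
                       , ⊆-trans (below fI) (below fL))
             (λ I ((fI , I∩H⊆L) , I⊆H) → begin
               Σ (through? I) (λ _ → w I)
                 ≈⟨ Σ-cong (through? I) (above? W H L ℓ) {g = λ _ → w I} (λ _ → proj₁)
                      (λ K a → a , ⊆-trans (⊆-trans (∩-absorb I⊆H) I∩H⊆L) (above-⊆ a)) (λ _ _ → refl) ⟩
               Σ (above? W H L ℓ) (λ _ → w I)
                 ≈⟨ Σ-const (above? W H L ℓ) (w I) ⟩
               w I * Σ (above? W H L ℓ) (λ _ → 1#)
                 ≈⟨ *-congˡ (count-above hyp fL) ⟩
               w I * fromℕ (q ^ (m ∸ ℓ))
                 ≈⟨ *-comm _ _ ⟩
               fromℕ (q ^ (m ∸ ℓ)) * w I ∎))
           (Σ-congˡ off? (λ I ((fI , I∩H⊆L) , I⊈H) →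
             let K , aK , unique = join hyp fL (sub fI) (below fI) I⊈H I∩H⊆L in
             Σ-single (through? I) {K} (λ _ → w I) aK unique)) ⟩
    Σ (flat? S L (suc j)) (λ I → fromℕ (q ^ (m ∸ ℓ)) * w I) + Σ off? w
      ≈⟨ +-cong (T-* (suc j) _ w L) (sym (T-trace hyp fL j w)) ⟩
    fromℕ (q ^ (m ∸ ℓ)) * T (suc j) w L + T j (trace W H j w) L ∎
    where
    near?    = λ I → flat? S W (suc j) I ×-dec ((I ∩ H) ⊆? L)
    on?      = λ I → near? I ×-dec (I ⊆? H)
    off?     = λ I → near? I ×-dec ¬? (I ⊆? H)
    through? = λ I K → above? W H L ℓ K ×-dec (I ⊆? K)

  InjectiveOn : Subset (card S) → ℕ → ℕ → Set
  InjectiveOn W i k = ∀ w → (∀ K → Flat S W k K → T i w K ≈ 0#) → ∀ I → Flat S W i I → w I ≈ 0#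

  module _ (hyp : Hyperplane W H m) (j<ℓ : suc j ≤ ℓ) (w : Subset (card S) → Carrier)
           (vanishes : ∀ K → Flat S W (suc ℓ) K → ¬ (K ⊆ H) → T (suc j) w K ≈ 0#)
           (injective : InjectiveOn H (suc j) ℓ) where
    private
      Q = fromℕ (q ^ (m ∸ ℓ))
      c = fromℕ (⟦ ℓ ∸ j ⟧ q) ⁻¹
      b = trace W H j w

    -- The factor `c` is the inverse of [ℓ-j], by which `T-∘` writes `T j b L` as the transform of
    -- `c * T j b` in rank ℓ. The double count then says that `T (suc j)` annihilates the
    -- combination at every `L`.
    weights-below : ∀ I → Flat S H (suc j) I → Q * w I + c * T j b I ≈ 0#
    weights-below = injective (λ I → Q * w I + c * T j b I) (λ L fL → begin
      T (suc j) (λ I → Q * w I + c * T j b I) L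
        ≈⟨ Σ-+ (flat? S L (suc j)) _ _ ⟩
      T (suc j) (λ I → Q * w I) L + T (suc j) (λ I → c * T j b I) L
        ≈⟨ +-cong (T-* (suc j) Q w L) (T-* (suc j) c (T j b) L) ⟩
      Q * T (suc j) w L + c * T (suc j) (T j b) L
        ≈⟨ +-congˡ (trans (*-congˡ (T-∘ (sub fL) (rank fL) j b)) (cancelˡ _ (⟦⟧-≉0 j<ℓ))) ⟩
      Q * T (suc j) w L + T j b L
        ≈⟨ sum-above hyp fL j w ⟨
      Σ (above? W H L ℓ) (T (suc j) w)
        ≈⟨ Σ-0 (above? W H L ℓ) (λ K a → vanishes K (proj₁ a) (above-⊈ fL a)) ⟩
      0# ∎)

    -- `weights-below` summed over the flats of `K`. Here `k` is free; taking it to be ℓ + 1 returns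
    -- from the rank of the double count to the rank of the original functions.
    sums-below : ∀ K → Flat S H k K → Q * T (suc j) w K + c * (fromℕ (⟦ k ∸ j ⟧ q) * T j b K) ≈ 0#
    sums-below {k = k} K fK = begin
      Q * T (suc j) w K + c * (fromℕ (⟦ k ∸ j ⟧ q) * T j b K)
        ≈⟨ +-congˡ (*-congˡ (T-∘ (sub fK) (rank fK) j b)) ⟨
      Q * T (suc j) w K + c * T (suc j) (T j b) K
        ≈⟨ +-cong (T-* (suc j) Q w K) (T-* (suc j) c (T j b) K) ⟨
      T (suc j) (λ I → Q * w I) K + T (suc j) (λ I → c * T j b I) K
        ≈⟨ Σ-+ (flat? S K (suc j)) _ _ ⟨
      T (suc j) (λ I → Q * w I + c * T j b I) K
        ≈⟨ Σ-0 (flat? S K (suc j)) (λ I fI → weights-below I (flat-⊆ (below fK) fI)) ⟩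
      0# ∎

  -- Induction on the rank of `W`. The hyperplane is chosen through the given `I`, so that `w I`
  -- itself occurs in `weights-below`. Both recursive calls lower i + k and the ambient rank by one,
  -- which preserves i + k ≤ m. For i = 0 there is a single weight, and for i = k the transform is
  -- the identity.
  T-injective : ∀ m {W} i k → i ≤ k → i +ℕ k ≤ m → IsSubspace S W → HasRank S W m → InjectiveOn W i k
  T-injective m zero k _ k≤m sW rW w Tw≈0 I fI =
    let K , fK , I⊆K = between sW rW fI z≤n k≤m in
    trans (sym (T-zero (sub fI) (rank fI) fK w I⊆K)) (Tw≈0 K fK)
  T-injective (suc m) {W} (suc j) k j<k i+k≤m sW rW w Tw≈0 I fI with ℕ.m≤n⇒m<n∨m≡n j<k
  ... | inj₂ ≡.refl = trans (sym (T-self (sub fI) (rank fI) w)) (Tw≈0 I fI)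
  ... | inj₁ (s≤s {n = ℓ} j<ℓ)
    with between sW rW fI (ℕ.≤-trans (ℕ.≤-trans j<ℓ (ℕ.<⇒≤ (ℕ.m≤n+m (suc ℓ) j))) (s≤s⁻¹ i+k≤m)) (ℕ.n≤1+n m)
  ...   | H , fH , I⊆H = x*y≈0⇒y≈0 (q^-≉0 (m ∸ ℓ)) (begin
    fromℕ (q ^ (m ∸ ℓ)) * w I
      ≈⟨ +-identityʳ _ ⟨
    fromℕ (q ^ (m ∸ ℓ)) * w I + 0#
      ≈⟨ +-congˡ (trans (*-congˡ Tb≈0) (zeroʳ c)) ⟨
    fromℕ (q ^ (m ∸ ℓ)) * w I + c * T j b I
      ≈⟨ weights-below hyp j<ℓ w (λ K fK _ → Tw≈0 K fK) injective I fI′ ⟩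
    0# ∎)
    where
    hyp = hyperplane sW rW fH
    c = fromℕ (⟦ ℓ ∸ j ⟧ q) ⁻¹
    b = trace W H j w
    fI′ : Flat S H (suc j) I
    fI′ = flat (sub fI) (rank fI) I⊆H
    injective : InjectiveOn H (suc j) ℓ
    injective = T-injective m (suc j) ℓ j<ℓ
      (ℕ.≤-trans (ℕ.≤-reflexive (≡.sym (ℕ.+-suc j ℓ))) (s≤s⁻¹ i+k≤m)) (sub fH) (rank fH)
    b≈0 : ∀ J → Flat S H j J → b J ≈ 0#
    -- For `K` inside `H` the sum over `w` is 0 by hypothesis, so `sums-below` leaves a non-zero
    -- multiple of `T j b K`.
    b≈0 = T-injective m j (suc ℓ) (ℕ.≤-trans (ℕ.n≤1+n j) j<k) (s≤s⁻¹ i+k≤m) (sub fH) (rank fH) b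
      (λ K fK → x*y≈0⇒y≈0 (⟦⟧-≉0 j<k) (x*y≈0⇒y≈0 (⁻¹-≉0 (⟦⟧-≉0 j<ℓ)) (begin
        c * (fromℕ (⟦ suc ℓ ∸ j ⟧ q) * T j b K)
          ≈⟨ +-identityˡ _ ⟨
        0# + c * (fromℕ (⟦ suc ℓ ∸ j ⟧ q) * T j b K)
          ≈⟨ +-congʳ (trans (*-congˡ (Tw≈0 K (flat-⊆ (below fH) fK))) (zeroʳ _)) ⟨
        fromℕ (q ^ (m ∸ ℓ)) * T (suc j) w K + c * (fromℕ (⟦ suc ℓ ∸ j ⟧ q) * T j b K)
          ≈⟨ sums-below hyp j<ℓ w (λ K fK _ → Tw≈0 K fK) injective K fK ⟩
        0# ∎)))
    Tb≈0 : T j b I ≈ 0#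
    Tb≈0 = Σ-0 (flat? S I j) (λ J fJ → b≈0 J (flat-⊆ I⊆H fJ))

  Degree≤ : Subset (card S) → ℕ → ℕ → (Subset (card S) → Carrier) → Set
  Degree≤ W i k f = ∃[ w ] ∀ K → Flat S W k K → f K ≈ T i w K

  -- By `T-∘` the function `T j w` divided by [k-j] serves as weights one rank higher. The weight
  -- formula for flats inside H has this origin.
  degree-suc : ∀ {f} → j < k → Degree≤ W j k f → Degree≤ W (suc j) k f
  degree-suc {j} {k} {f = f} j<k (w , eq) = (λ I → fromℕ (⟦ k ∸ j ⟧ q) ⁻¹ * T j w I) , λ K fK → begin
    f K                                          ≈⟨ eq K fK ⟩
    T j w K                                      ≈⟨ cancelˡ _ (⟦⟧-≉0 j<k) ⟨
    c * (fromℕ (⟦ k ∸ j ⟧ q) * T j w K)          ≈⟨ *-congˡ (T-∘ (sub fK) (rank fK) j w) ⟨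
    c * T (suc j) (T j w) K                      ≈⟨ T-* (suc j) c (T j w) K ⟨
    T (suc j) (λ I → c * T j w I) K              ∎
    where c = fromℕ (⟦ k ∸ j ⟧ q) ⁻¹

  degree-mono : ∀ {f} → i ≤ j → j ≤ k → Degree≤ W i k f → Degree≤ W j k f
  degree-mono {k = k} {W} {f} i≤j = climb (ℕ.≤⇒≤′ i≤j)
    where
    climb : ∀ {i j} → i ≤′ j → j ≤ k → Degree≤ W i k f → Degree≤ W j k f
    climb ≤′-refl       j≤k d = d
    climb (≤′-step i≤j) j≤k d = degree-suc j≤k (climb i≤j (ℕ.<⇒≤ j≤k) d)

  -- `sums-below` with k = ℓ + 1, solved for the sum over `w`. The injectivity it uses is in rank ℓ
  -- on `H`, where the condition (j + 1) + ℓ ≤ m is the given one lowered by one on both sides.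
  degree-drop : Hyperplane W H m → suc j < k → suc j +ℕ k ≤ suc m → ∀ w →
                (∀ K → Flat S W k K → ¬ (K ⊆ H) → T (suc j) w K ≈ 0#) →
                Degree≤ H j k (T (suc j) w)
  degree-drop {W} {H} {m} {j} {suc ℓ} hyp (s≤s j<ℓ) i+k≤m w vanishes = (λ J → a * b J) , λ K fK → begin
    T (suc j) w K
      ≈⟨ cancelˡ _ (q^-≉0 (m ∸ ℓ)) ⟨
    Q ⁻¹ * (Q * T (suc j) w K)
      ≈⟨ *-congˡ (inverseˡ-unique _ _ (sums-below hyp j<ℓ w vanishes
           (T-injective m (suc j) ℓ j<ℓ
             (ℕ.≤-trans (ℕ.≤-reflexive (≡.sym (ℕ.+-suc j ℓ))) (s≤s⁻¹ i+k≤m))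
             (sub (isFlat hyp)) (rank (isFlat hyp)))
           K fK)) ⟩
    Q ⁻¹ * - (c * (d * T j b K))
      ≈⟨ *-congˡ (-‿cong (*-assoc _ _ _)) ⟨
    Q ⁻¹ * - (c * d * T j b K)
      ≈⟨ *-congˡ (-‿distribˡ-* _ _) ⟩
    Q ⁻¹ * (- (c * d) * T j b K)
      ≈⟨ *-assoc _ _ _ ⟨
    a * T j b K
      ≈⟨ T-* j a b K ⟨
    T j (λ J → a * b J) K ∎
    where
    Q = fromℕ (q ^ (m ∸ ℓ))
    c = fromℕ (⟦ ℓ ∸ j ⟧ q) ⁻¹
    d = fromℕ (⟦ suc ℓ ∸ j ⟧ q)
    a = Q ⁻¹ * - (c * d)
    b = trace W H j w
    open GroupProperties +-group using (inverseˡ-unique)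

  -- In rank 0 the transform has the constant value `w 𝟘`. As k > 0, a point off `H` extends to a
  -- flat of rank k off `H`, where this constant is seen to be 0.
  constant-drop : Hyperplane W H m → 0 < k → k ≤ suc m → ∀ w →
                  (∀ K → Flat S W k K → ¬ (K ⊆ H) → T 0 w K ≈ 0#) →
                  ∀ K → Flat S H k K → T 0 w K ≈ 0#
  constant-drop {W} {H} {m} {k} hyp 0<k k≤m w vanishes K fK
    with ⊈-witness (λ W⊆H → ℕ.<-irrefl ≡.refl
           (rank-mono (ambient hyp) (ambient-rank hyp) (rank (isFlat hyp)) W⊆H))
  ... | p , p∈W , p∉H with between (ambient hyp) (ambient-rank hyp)
                            (flat (⊕-sub 𝟘-sub) (⊕-rank 𝟘-sub 𝟘-rank (p∉H ∘ 𝟘-least (sub (isFlat hyp))))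
                                  (⊕-least (ambient hyp) (𝟘-least (ambient hyp)) p∈W)) 0<k k≤m
  ... | M , fM , 𝟘⊕p⊆M = begin
    T 0 w K  ≈⟨ T-zero 𝟘-sub 𝟘-rank fK w (𝟘-least (sub fK)) ⟩
    w 𝟘      ≈⟨ T-zero 𝟘-sub 𝟘-rank fM w (𝟘-least (sub fM)) ⟨
    T 0 w M  ≈⟨ vanishes M fM (λ M⊆H → p∉H (M⊆H (𝟘⊕p⊆M (∈-⊕ 𝟘-sub)))) ⟩
    0#       ∎

  -- The stated weights for e = j + 1, so `k ∸ j` is k - e + 1. The value inside `H` is that of
  -- `degree-suc`; the value off `H` is chosen to balance it in the sum over any `K` off `H`.
  extension : (H : Subset (card S)) (k j : ℕ) → (Subset (card S) → Carrier) → Subset (card S) → Carrier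
  extension H k j w E with E ⊆? H
  ... | yes _ = fromℕ (⟦ k ∸ j ⟧ q) ⁻¹ * T j w E
  ... | no  _ = - (fromℕ (⟦ k ∸ suc j ⟧ q) * (fromℕ (q ^ (k ∸ suc j)) * fromℕ (⟦ k ∸ j ⟧ q)) ⁻¹) * w (E ∩ H)

  extension-⊆ : ∀ w → U ⊆ H → extension H k j w U ≈ fromℕ (⟦ k ∸ j ⟧ q) ⁻¹ * T j w U
  extension-⊆ {U} {H} w U⊆H with U ⊆? H
  ... | yes _  = refl
  ... | no U⊈H = contradiction (λ {x} → U⊆H {x}) U⊈H

  extension-⊈ : ∀ w → ¬ (U ⊆ H) → extension H k j w U ≈
    - (fromℕ (⟦ k ∸ suc j ⟧ q) * (fromℕ (q ^ (k ∸ suc j)) * fromℕ (⟦ k ∸ j ⟧ q)) ⁻¹) * w (U ∩ H)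
  extension-⊈ {U} {H} w U⊈H with U ⊆? H
  ... | yes U⊆H = contradiction (λ {x} → U⊆H {x}) U⊈H
  ... | no _    = refl

  T-extension-⊆ : IsSubspace S K → HasRank S K k → j < k → K ⊆ H → ∀ w →
                  T (suc j) (extension H k j w) K ≈ T j w K
  T-extension-⊆ {K} {k} {j} {H} sK rK j<k K⊆H w = begin
    T (suc j) (extension H k j w) K
      ≈⟨ Σ-congˡ (flat? S K (suc j)) (λ E fE → extension-⊆ w (⊆-trans (below fE) K⊆H)) ⟩
    T (suc j) (λ E → fromℕ (⟦ k ∸ j ⟧ q) ⁻¹ * T j w E) K
      ≈⟨ T-* (suc j) _ (T j w) K ⟩
    fromℕ (⟦ k ∸ j ⟧ q) ⁻¹ * T (suc j) (T j w) K
      ≈⟨ *-congˡ (T-∘ sK rK j w) ⟩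
    fromℕ (⟦ k ∸ j ⟧ q) ⁻¹ * (fromℕ (⟦ k ∸ j ⟧ q) * T j w K)
      ≈⟨ cancelˡ _ (⟦⟧-≉0 j<k) ⟩
    T j w K ∎

  -- With L = K ∩ H and e = j + 1, the flats E ≤ H contribute ([k-e]/[k-e+1]) T_j w L and the others
  -- -([k-e]/[k-e+1]) T_j w L, since each J ≤ L of rank j is the trace on H of q^(k-e) of them.
  T-extension-⊈ : Hyperplane W H m → Flat S W k K → j < k → ¬ (K ⊆ H) → ∀ w →
                  T (suc j) (extension H k j w) K ≈ 0#
  T-extension-⊈ {W} {H} {m} {k} {K} {j} hyp fK j<k K⊈H w with meet-flat hyp fK K⊈H
  ... | ℓ , ≡.refl , fL = begin
    Σ (flat? S K (suc j)) v
      ≈⟨ Σ-split (flat? S K (suc j)) (_⊆? H) v ⟩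
    Σ (λ E → flat? S K (suc j) E ×-dec (E ⊆? H)) v + Σ (λ E → flat? S K (suc j) E ×-dec ¬? (E ⊆? H)) v
      ≈⟨ +-cong on off ⟩
    a * (A * T j w K∩H) + - (A * (Q * D) ⁻¹) * (Q * T j w K∩H)
      ≈⟨ +-cong (sym (*-assoc _ _ _)) (sym (*-assoc _ _ _)) ⟩
    a * A * T j w K∩H + - (A * (Q * D) ⁻¹) * Q * T j w K∩H
      ≈⟨ distribʳ _ _ _ ⟨
    (a * A + - (A * (Q * D) ⁻¹) * Q) * T j w K∩H
      ≈⟨ *-congʳ cancels ⟩
    0# * T j w K∩H
      ≈⟨ zeroˡ _ ⟩
    0# ∎
    where
    K∩H = K ∩ H
    v = extension H (suc ℓ) j w
    D = fromℕ (⟦ suc ℓ ∸ j ⟧ q)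
    A = fromℕ (⟦ ℓ ∸ j ⟧ q)
    Q = fromℕ (q ^ (ℓ ∸ j))
    a = D ⁻¹

    -- The flats E are counted with `K` as ambient space, which is why the exponent of q is ℓ - j =
    -- k - e and does not involve m.
    hypK : Hyperplane K K∩H ℓ
    hypK = hyperplane (sub fK) (rank fK) (flat (sub fL) (rank fL) (p∩q⊆p K H))

    cancels : a * A + - (A * (Q * D) ⁻¹) * Q ≈ 0#
    cancels = begin
      a * A + - (A * (Q * D) ⁻¹) * Q
        ≈⟨ +-congˡ (-‿distribˡ-* _ _) ⟨
      a * A + - (A * (Q * D) ⁻¹ * Q)
        ≈⟨ +-congˡ (-‿cong (trans (*-assoc _ _ _) (trans (*-congˡ QD⁻¹Q) (*-comm _ _)))) ⟩
      a * A + - (a * A)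
        ≈⟨ -‿inverseʳ _ ⟩
      0# ∎
      where
      D≉0 = ⟦⟧-≉0 j<k
      QD≉0 = *-≉0 (q^-≉0 (ℓ ∸ j)) D≉0
      QD⁻¹Q : (Q * D) ⁻¹ * Q ≈ a
      QD⁻¹Q = begin
        (Q * D) ⁻¹ * Q              ≈⟨ *-identityʳ _ ⟨
        (Q * D) ⁻¹ * Q * 1#         ≈⟨ *-congˡ (*-inverseʳ D D≉0) ⟨
        (Q * D) ⁻¹ * Q * (D * a)    ≈⟨ *-assoc _ _ _ ⟩
        (Q * D) ⁻¹ * (Q * (D * a))  ≈⟨ *-congˡ (*-assoc _ _ _) ⟨
        (Q * D) ⁻¹ * (Q * D * a)    ≈⟨ cancelˡ a QD≉0 ⟩
        a                           ∎

    on : Σ (λ E → flat? S K (suc j) E ×-dec (E ⊆? H)) v ≈ a * (A * T j w K∩H)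
    on = begin
      Σ (λ E → flat? S K (suc j) E ×-dec (E ⊆? H)) v
        ≈⟨ Σ-cong (λ E → flat? S K (suc j) E ×-dec (E ⊆? H)) (flat? S K∩H (suc j))
             (λ E (fE , E⊆H) → flat (sub fE) (rank fE) (λ x∈E → x∈p∩q⁺ (below fE x∈E , E⊆H x∈E)))
             (λ E fE → flat-⊆ (p∩q⊆p K H) fE , ⊆-trans (below fE) (p∩q⊆q K H))
             (λ E (fE , E⊆H) → extension-⊆ w E⊆H) ⟩
      T (suc j) (λ E → a * T j w E) K∩H
        ≈⟨ T-* (suc j) a (T j w) K∩H ⟩
      a * T (suc j) (T j w) K∩H
        ≈⟨ *-congˡ (T-∘ (sub fL) (rank fL) j w) ⟩
      a * (A * T j w K∩H) ∎

    off : Σ (λ E → flat? S K (suc j) E ×-dec ¬? (E ⊆? H)) v ≈ - (A * (Q * D) ⁻¹) * (Q * T j w K∩H)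
    off = begin
      Σ off? v
        ≈⟨ Σ-congˡ off? (λ E (fE , E⊈H) → extension-⊈ w E⊈H) ⟩
      Σ off? (λ E → - (A * (Q * D) ⁻¹) * w (E ∩ H))
        ≈⟨ Σ-* off? _ _ ⟩
      - (A * (Q * D) ⁻¹) * Σ off? (λ E → w (E ∩ H))
        ≈⟨ *-congˡ traces ⟩
      - (A * (Q * D) ⁻¹) * (Q * T j w K∩H) ∎
      where
      off? = λ E → flat? S K (suc j) E ×-dec ¬? (E ⊆? H)
      ∩L≡∩H : ∀ {E} → E ⊆ K → E ∩ K∩H ≡ E ∩ H
      ∩L≡∩H {E} E⊆K = ⊆-antisym
        (λ x∈ → let x∈E , x∈L = x∈p∩q⁻ E K∩H x∈ in x∈p∩q⁺ (x∈E , p∩q⊆q K H x∈L))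
        (λ x∈ → let x∈E , x∈H = x∈p∩q⁻ E H x∈ in x∈p∩q⁺ (x∈E , x∈p∩q⁺ (E⊆K x∈E , x∈H)))
      traces : Σ off? (λ E → w (E ∩ H)) ≈ Q * T j w K∩H
      traces = begin
        Σ off? (λ E → w (E ∩ H))
          ≈⟨ Σ-congˡ off? (λ E _ → Σ-single (λ J → J ≟ˢ (E ∩ H)) w ≡.refl (λ _ → id)) ⟨
        Σ off? (λ E → Σ (λ J → J ≟ˢ (E ∩ H)) w)
          ≈⟨ Σ-swap off? (λ E J → J ≟ˢ (E ∩ H)) (flat? S K∩H j) (λ J → above? K K∩H J j) (λ _ J → w J)
               (λ { E J ((fE , E⊈H) , ≡.refl) →
                 let eq = ∩L≡∩H (below fE)
                     f  = meet-flat-suc hypK fE (λ E⊆L → E⊈H (⊆-trans E⊆L (p∩q⊆q K H)))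
                 in ≡.subst (Flat S K∩H j) eq f , fE , eq })
               (λ E J (fJ , a@(fE , E∩L≡J)) →
                 (fE , λ E⊆H → above-⊈ fJ a (λ x∈E → x∈p∩q⁺ (below fE x∈E , E⊆H x∈E)))
                 , ≡.trans (≡.sym E∩L≡J) (∩L≡∩H (below fE))) ⟩
        Σ (flat? S K∩H j) (λ J → Σ (above? K K∩H J j) (λ _ → w J))
          ≈⟨ Σ-congˡ (flat? S K∩H j) (λ J fJ →
               trans (Σ-const (above? K K∩H J j) (w J))
                     (trans (*-congˡ (count-above hypK fJ)) (*-comm _ _))) ⟩
        Σ (flat? S K∩H j) (λ J → Q * w J)
          ≈⟨ T-* j Q w K∩H ⟩
        Q * T j w K∩H ∎

-- From functions on Grassmannians to functions on all subsets.

module GrassmannianSums (ℝ : RealNumbers) (S : Space) where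
  open RealNumbers ℝ using (Carrier; _+_; 0#; sum; refl; sym; trans;
    +-cong; +-congˡ; +-identityˡ; +-identityʳ; +-assoc; *-congˡ; *-identityʳ; zeroʳ)
  open SubsetSums ℝ
  open Functions ℝ S
  open Flat

  private
    variable
      U W : Subset (card S)
      i k : ℕ

  -- The irrelevant proof can be recomputed because being a flat is decidable.
  toFlat : (K : Grassmannian S W k) → Flat S W k (value K)
  toFlat {W} {k} (K ,ᵍ [ p ]) = recompute (flat? S W k K) (flat (proj₁ p) (proj₁ (proj₂ p)) (proj₂ (proj₂ p)))

  fromFlat : Flat S W k U → Grassmannian S W k
  fromFlat {U = U} (flat s r b) = U ,ᵍ [ s , r , (λ {x} → b {x}) ]

  -- The value 0 is a mere default: the sums below only read values at flats of `W` of rank `k`.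
  zeroExtend : ℝ^[ W , k ] → Subset (card S) → Carrier
  zeroExtend {W} {k} f U with flat? S W k U
  ... | yes fU = f (fromFlat fU)
  ... | no  _  = 0#

  zeroExtend-value : (f : ℝ^[ W , k ]) (K : Grassmannian S W k) → zeroExtend f (value K) ≈ f K
  zeroExtend-value {W} {k} f K with flat? S W k (value K)
  ... | yes _ = refl
  ... | no ¬f = contradiction (toFlat K) ¬f

  zeroExtend-flat : (f : ℝ^[ W , k ]) (fU : Flat S W k U) → zeroExtend f U ≈ f (fromFlat fU)
  zeroExtend-flat f fU = zeroExtend-value f (fromFlat fU)

  listSum : ∀ {N} → List (Subset N) → (Subset N → Carrier) → Carrier
  listSum []       h = 0#
  listSum (U ∷ Us) h = h U + listSum Us h

  listSum-++ : ∀ {N} (Us Vs : List (Subset N)) h → listSum (Us ++ Vs) h ≈ listSum Us h + listSum Vs h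
  listSum-++ []       Vs h = sym (+-identityˡ _)
  listSum-++ (U ∷ Us) Vs h = trans (+-congˡ (listSum-++ Us Vs h)) (sym (+-assoc _ _ _))

  listSum-map : ∀ {M N} (φ : Subset M → Subset N) Us h → listSum (List.map φ Us) h ≈ listSum Us (h ∘ φ)
  listSum-map φ []       h = refl
  listSum-map φ (U ∷ Us) h = +-congˡ (listSum-map φ Us h)

  listSum-allSubsets : ∀ N h → listSum (allSubsets N) h ≈ sumAll N h
  listSum-allSubsets zero    h = +-identityʳ _
  listSum-allSubsets (suc N) h = trans (listSum-++ (List.map (inside ∷_) (allSubsets N)) _ h)
    (+-cong (trans (listSum-map (inside ∷_) (allSubsets N) h) (listSum-allSubsets N _))
            (trans (listSum-map (outside ∷_) (allSubsets N) h) (listSum-allSubsets N _)))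

  -- `enumerate` discards the subsets that are not flats; keeping them with value 0 instead gives a
  -- sum over all subsets.
  sum-mapMaybe : ∀ {A : Set} (g : A → Carrier) {N} (φ : Subset N → Maybe A) Us →
                 sum (g ∘ List.lookup (List.mapMaybe φ Us)) ≈ listSum Us (maybe′ g 0# ∘ φ)
  sum-mapMaybe g φ [] = refl
  sum-mapMaybe g φ (U ∷ Us) with φ U
  ... | just _  = +-congˡ (sum-mapMaybe g φ Us)
  ... | nothing = trans (sum-mapMaybe g φ Us) (sym (+-identityˡ _))

  ∑-as-Σ : (g : ℝ^[ W , i ]) → ∑ g ≈ Σ (flat? S W i) (zeroExtend g)
  ∑-as-Σ {W} {i} g = trans (sum-mapMaybe g _ (allSubsets (card S)))
    (trans (listSum-allSubsets (card S) _)
           (sumAll-cong (card S) (λ U → term U (isSubspace? S U ×-dec hasRank? S U i ×-dec (U ⊆? W)))))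
    where
    term : ∀ U (d : Dec (IsSubspace S U × HasRank S U i × U ⊆ W)) →
           maybe′ g 0# (Maybe.map (λ p → U ,ᵍ [ p ]) (dec⇒maybe d)) ≈ when (flat? S W i U) (zeroExtend g U)
    term U (yes (s , r , b)) = sym
      (trans (when-yes (flat? S W i U) (flat s r b)) (zeroExtend-flat g (flat s r b)))
    term U (no ¬p) = sym (when-no (flat? S W i U) (λ (flat s r b) → ¬p (s , r , λ {x} → b {x})))

  𝒙-⊆ : (I : Grassmannian S W i) (K : Grassmannian S W k) → value I ⊆ value K → 𝒙 k I K ≈ 1#
  𝒙-⊆ I K I⊆K with value I ⊆? value K
  ... | yes _  = refl
  ... | no I⊈K = contradiction (λ {x} → I⊆K {x}) I⊈K

  𝒙-⊈ : (I : Grassmannian S W i) (K : Grassmannian S W k) → ¬ (value I ⊆ value K) → 𝒙 k I K ≈ 0#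
  𝒙-⊈ I K I⊈K with value I ⊆? value K
  ... | yes I⊆K = contradiction (λ {x} → I⊆K {x}) I⊈K
  ... | no _    = refl

  -- The factor `𝒙 k I K` removes exactly the `I` not below `K`, and what remains is the transform
  -- `T` of the zero extension.
  expansion-as-Σ : (w : ℝ^[ W , i ]) (K : Grassmannian S W k) →
                   expansion k w K ≈ Σ (flat? S (value K) i) (zeroExtend w)
  expansion-as-Σ {W} {i} {k} w K = trans (∑-as-Σ _) (sumAll-cong (card S) term)
    where
    term : ∀ U → when (flat? S W i U) (zeroExtend (λ I → w I * 𝒙 k I K) U)
               ≈ when (flat? S (value K) i U) (zeroExtend w U)
    term U = byCases (flat? S W i U) (U ⊆? value K)
      where
      byCases : Dec (Flat S W i U) → Dec (U ⊆ value K) →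
                when (flat? S W i U) (zeroExtend (λ I → w I * 𝒙 k I K) U)
                ≈ when (flat? S (value K) i U) (zeroExtend w U)
      byCases (yes fU) (yes U⊆K) = trans (when-yes (flat? S W i U) fU)
        (trans (zeroExtend-flat (λ I → w I * 𝒙 k I K) fU)
        (trans (trans (*-congˡ (𝒙-⊆ (fromFlat fU) K U⊆K)) (*-identityʳ _))
        (trans (sym (zeroExtend-flat w fU))
               (sym (when-yes (flat? S (value K) i U) (flat (sub fU) (rank fU) U⊆K))))))
      byCases (yes fU) (no U⊈K) = trans (when-yes (flat? S W i U) fU)
        (trans (zeroExtend-flat (λ I → w I * 𝒙 k I K) fU)
        (trans (trans (*-congˡ (𝒙-⊈ (fromFlat fU) K U⊈K)) (zeroʳ _))
               (sym (when-no (flat? S (value K) i U) (λ f → U⊈K (below f))))))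
      byCases (no ¬fU) _ = trans (when-no (flat? S W i U) ¬fU)
        (sym (when-no (flat? S (value K) i U)
          (λ (flat s r b) → ¬fU (flat s r (⊆-trans b (below (toFlat K)))))))

-- Linearity, injectivity and image of Ψ.

module Embedding (ℝ : RealNumbers) (S : Space) (h : Subset (card S)) (k : ℕ) where
  open RealNumbers ℝ using (0#; _+_; refl; sym; trans; +-identityˡ; zeroʳ; +-group)
  open RealProperties ℝ using (_≈?_)
  open Functions ℝ S
  open GrassmannianSums ℝ S
  open Flat
  private
    Ψ′ = Ψ {h} {k}

  Ψ-restrict : ∀ f K (K⊆h : value K ⊆ h) → Ψ′ f K ≈ f (restrict K K⊆h)
  Ψ-restrict f K K⊆h with value K ⊆? h
  ... | yes _  = refl
  ... | no K⊈h = contradiction (λ {x} → K⊆h {x}) K⊈h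

  Ψ-⊆ : ∀ f K → value K ⊆ h → Ψ′ f K ≈ zeroExtend f (value K)
  Ψ-⊆ f K K⊆h = trans (Ψ-restrict f K K⊆h) (sym (zeroExtend-value f (restrict K (λ {x} → K⊆h {x}))))

  Ψ-⊈ : ∀ f K → ¬ (value K ⊆ h) → Ψ′ f K ≈ 0#
  Ψ-⊈ f K K⊈h with value K ⊆? h
  ... | yes K⊆h = contradiction (λ {x} → K⊆h {x}) K⊈h
  ... | no _    = refl

  Ψ-weaken : ∀ f (K : Grassmannian S h k) → Ψ′ f (weaken ⊆⊤ K) ≈ f K
  Ψ-weaken f K = trans (Ψ-⊆ f (weaken ⊆⊤ K) (below (toFlat K))) (zeroExtend-value f K)

  Ψ-cong : ∀ {f g} → f ≐ g → Ψ′ f ≐ Ψ′ g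
  Ψ-cong f≐g K with value K ⊆? h
  ... | yes _ = f≐g _
  ... | no _  = refl

  Ψ-𝟎 : Ψ′ 𝟎 ≐ 𝟎
  Ψ-𝟎 K with value K ⊆? h
  ... | yes _ = refl
  ... | no _  = refl

  Ψ-injective : ∀ {f g} → Ψ′ f ≐ Ψ′ g → f ≐ g
  Ψ-injective {f} {g} eq K = trans (sym (Ψ-weaken f K)) (trans (eq (weaken ⊆⊤ K)) (Ψ-weaken g K))

  isInjectiveLinear : IsInjectiveLinear Ψ′
  isInjectiveLinear = record
    { isLeftModuleHomomorphism = record
      { +ᴹ-isGroupHomomorphism = record
        { isMonoidHomomorphism = record
          { isMagmaHomomorphism = record
            { isRelHomomorphism = record { cong = Ψ-cong }
            ; homo              = Ψ-+
            }
          ; ε-homo = Ψ-𝟎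
          }
        ; ⁻¹-homo = Ψ-neg
        }
      ; *ₗ-homo = Ψ-*
      }
    ; injective = Ψ-injective
    }
    where
    Ψ-+ : ∀ f g → Ψ′ (λ K → f K + g K) ≐ (λ K → Ψ′ f K + Ψ′ g K)
    Ψ-+ f g K with value K ⊆? h
    ... | yes _ = refl
    ... | no _  = sym (+-identityˡ 0#)
    Ψ-neg : ∀ f → Ψ′ (λ K → - f K) ≐ (λ K → - Ψ′ f K)
    Ψ-neg f K with value K ⊆? h
    ... | yes _ = refl
    ... | no _  = sym (GroupProperties.ε⁻¹≈ε +-group)
    Ψ-* : ∀ c f → Ψ′ (λ K → c * f K) ≐ (λ K → c * Ψ′ f K)
    Ψ-* c f K with value K ⊆? h
    ... | yes _ = refl
    ... | no _  = sym (zeroʳ c)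

  image⇔support : ∀ g → Image Ψ′ g ⇔ (∀ K → Support g K → value K ⊆ h)
  image⇔support g = mk⇔ supported preimage
    where
    supported : Image Ψ′ g → ∀ K → Support g K → value K ⊆ h
    supported (f , eq) K gK≉0 = decidable-stable (value K ⊆? h)
      (λ K⊈h → gK≉0 (trans (sym (eq K)) (Ψ-⊈ f K K⊈h)))

    preimage : (∀ K → Support g K → value K ⊆ h) → Image Ψ′ g
    preimage supp = f , λ K → agree K (value K ⊆? h)
      where
      f : ℝ^[ h , k ]
      f K = g (weaken ⊆⊤ K)
      agree : ∀ K → Dec (value K ⊆ h) → Ψ′ f K ≈ g K
      agree K (yes K⊆h) = Ψ-restrict f K K⊆h
      -- The support condition only refutes `g K` being non-zero; decidable equality of reals makes
      -- this an equation.
      agree K (no K⊈h)  = trans (Ψ-⊈ f K K⊈h)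
        (sym (decidable-stable (g K ≈? 0#) (λ gK≉0 → K⊈h (supp K gK≉0))))

-- Degree and weight distribution of Ψ f.

module Degrees (ℝ : RealNumbers) (S : Space) {m : ℕ} (⊤-rank : HasRank S ⊤ (suc m))
               (H : Grassmannian S ⊤ m) (k : ℕ) (k≤m : k ≤ m) where
  open RealNumbers ℝ using (Carrier; 0#; _+_; _⁻¹; refl; sym; trans; reflexive;
    +-cong; +-congˡ; *-congˡ; *-cong; *-identityˡ; -‿inverseʳ; setoid; ring; +-group)
  open RealProperties ℝ
  open SubsetSums ℝ
  open Functions ℝ S
  open GrassmannianSums ℝ S
  open Geometry S (subspaceLaws S) ⊤-rank
  open Transforms ℝ S (subspaceLaws S) ⊤-rank
  open Flat
  open SetoidReasoning setoid

  private
    h = value H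
    q = baseOrder S
  open Embedding ℝ S h k

  private
    variable
      W : Subset (card S)
      i j : ℕ

  hyp : Hyperplane ⊤ h m
  hyp = hyperplane ⊤-sub ⊤-rank (toFlat H)

  suc-m∸k : suc m ∸ k ≡ suc (m ∸ k)
  suc-m∸k = ℕ.+-∸-assoc 1 k≤m

  zeroExtend-restricted : ∀ (w : Subset (card S) → Carrier) K → K ⊆ W →
                          T i (zeroExtend {W} {i} (w ∘ value)) K ≈ T i w K
  zeroExtend-restricted {W} {i} w K K⊆W =
    Σ-congˡ (flat? S K i) (λ U fU → zeroExtend-flat {W} (w ∘ value) (flat-⊆ K⊆W fU))

  V̄⇒Degree≤ : ∀ {f : ℝ^[ W , k ]} → V̄ W i k f → Degree≤ W i k (zeroExtend f)
  V̄⇒Degree≤ {f = f} (w , eq) = zeroExtend w , λ K fK →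
    trans (zeroExtend-flat f fK) (trans (eq (fromFlat fK)) (expansion-as-Σ w (fromFlat fK)))

  Degree≤⇒expansion : ∀ {f : ℝ^[ W , k ]} (w : Subset (card S) → Carrier) →
                      (∀ K → f K ≈ T i w (value K)) → f ≐ expansion {W} {i} k (w ∘ value)
  Degree≤⇒expansion {W} {i} {f} w eq K = trans (eq K)
    (sym (trans (expansion-as-Σ {W} {i} (w ∘ value) K)
                (zeroExtend-restricted w (value K) (below (toFlat K)))))

  Degree≤⇒V̄ : ∀ {f : ℝ^[ W , k ]} → Degree≤ W i k (zeroExtend f) → V̄ W i k f
  Degree≤⇒V̄ {f = f} (w , eq) = w ∘ value ,
    Degree≤⇒expansion w (λ K → trans (sym (zeroExtend-value f K)) (eq (value K) (toFlat K)))

  -- The difference of two weight functions of `f` is annihilated by the transform, so `T-injective`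
  -- gives uniqueness. Writing it with the factor `- 1#` lets `T-*` apply.
  isWeightDistribution : ∀ {l} {f : ℝ^[ W , k ]} {w : ℝ^[ W , i ]} →
                         IsSubspace S W → HasRank S W l → i ≤ k → i +ℕ k ≤ l →
                         f ≐ expansion k w → IsWeightDistribution i f w
  isWeightDistribution {W} {i} {l} {f} {w} sW rW i≤k i+k≤l eq = eq , λ w′ eq′ I →
    let δ = λ U → zeroExtend w U + (- 1#) * zeroExtend w′ U
        Tδ≈0 : ∀ K → Flat S W k K → T i δ K ≈ 0#
        Tδ≈0 = λ K fK → begin
          T i δ K
            ≈⟨ Σ-+ (flat? S K i) _ _ ⟩
          T i (zeroExtend w) K + T i (λ U → (- 1#) * zeroExtend w′ U) K
            ≈⟨ +-congˡ (T-* i (- 1#) (zeroExtend w′) K) ⟩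
          T i (zeroExtend w) K + (- 1#) * T i (zeroExtend w′) K
            ≈⟨ +-cong (expansion-as-Σ w (fromFlat fK)) (*-congˡ (expansion-as-Σ w′ (fromFlat fK))) ⟨
          expansion k w (fromFlat fK) + (- 1#) * expansion k w′ (fromFlat fK)
            ≈⟨ +-cong (eq (fromFlat fK)) (trans (sym (-1*x≈-x _)) (*-congˡ (eq′ (fromFlat fK)))) ⟨
          f (fromFlat fK) + - f (fromFlat fK)
            ≈⟨ -‿inverseʳ _ ⟩
          0# ∎
    in x∙y⁻¹≈ε⇒x≈y _ _ (begin
         w I + - w′ I
           ≈⟨ +-cong (zeroExtend-value w I) (trans (*-congˡ (zeroExtend-value w′ I)) (-1*x≈-x _)) ⟨
         δ (value I)
           ≈⟨ T-injective l i k i≤k i+k≤l sW rW δ Tδ≈0 (value I) (toFlat I) ⟩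
         0# ∎)
    where
    open RingProperties ring using (-1*x≈-x)
    open GroupProperties +-group using (x∙y⁻¹≈ε⇒x≈y)

  module _ (f : ℝ^[ h , k ]) where

    Ψ-expansion : j < k → (w : Subset (card S) → Carrier) → (∀ K → Flat S h k K → zeroExtend f K ≈ T j w K) →
                  Ψ f ≐ expansion k (extension h k j w ∘ value)
    Ψ-expansion {j} j<k w eq =
      Degree≤⇒expansion (extension h k j w) (λ K → values K (toFlat K) (value K ⊆? h))
      where
      values : ∀ K → Flat S ⊤ k (value K) → Dec (value K ⊆ h) →
               Ψ f K ≈ T (suc j) (extension h k j w) (value K)
      values K fK (yes K⊆h) = begin
        Ψ f K                                      ≈⟨ Ψ-⊆ f K K⊆h ⟩
        zeroExtend f (value K)                     ≈⟨ eq (value K) (flat (sub fK) (rank fK) K⊆h) ⟩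
        T j w (value K)                            ≈⟨ T-extension-⊆ (sub fK) (rank fK) j<k K⊆h w ⟨
        T (suc j) (extension h k j w) (value K)    ∎
      values K fK (no K⊈h) = trans (Ψ-⊈ f K K⊈h) (sym (T-extension-⊈ hyp fK j<k K⊈h w))

    Ψ-degree≤ : ∀ t → V̄ h t k f → V̄ ⊤ (suc t ⊓ k) k (Ψ f)
    Ψ-degree≤ t d with suc t ℕ.≤? k
    ... | yes t<k = ≡.subst (λ s → V̄ ⊤ s k (Ψ f)) (≡.sym (ℕ.m≤n⇒m⊓n≡m t<k))
                      (let w , eq = V̄⇒Degree≤ d in extension h k t w ∘ value , Ψ-expansion t<k w eq)
    -- Now the minimum is k, and in rank k every function is its own weight function.
    ... | no  t≮k = ≡.subst (λ s → V̄ ⊤ s k (Ψ f)) (≡.sym (ℕ.m≥n⇒m⊓n≡n (ℕ.<⇒≤ (ℕ.≰⇒> t≮k))))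
                      (Ψ f , λ K → sym (trans (expansion-as-Σ (Ψ f) K)
                        (trans (T-self (sub (toFlat K)) (rank (toFlat K)) (zeroExtend (Ψ f)))
                               (zeroExtend-value (Ψ f) K))))

    module _ {s : ℕ} (w : Subset (card S) → Carrier)
             (eq : ∀ K → Flat S ⊤ k K → zeroExtend (Ψ f) K ≈ T s w K) where

      vanishes : ∀ K → Flat S ⊤ k K → ¬ (K ⊆ h) → T s w K ≈ 0#
      vanishes K fK K⊈h = trans (sym (eq K fK)) (trans (zeroExtend-flat (Ψ f) fK) (Ψ-⊈ f (fromFlat fK) K⊈h))

      agrees : ∀ K → Flat S h k K → zeroExtend f K ≈ T s w K
      agrees K fK = trans (sym (Ψ-⊆ f (fromFlat fK⊤) (below fK)))
                          (trans (sym (zeroExtend-flat (Ψ f) fK⊤)) (eq K fK⊤))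
        where fK⊤ = flat-⊆ ⊆⊤ fK

    -- For s ≥ k the bound is immediate. For s = 0 < k, `constant-drop` would give f = 0. For s = j
    -- + 1 < k, `degree-drop` bounds the degree of f by j, so t ≤ j; since m - k is one less than
    -- the bound m + 1 - k for s, this j is admissible on H.
    Ψ-degree≥ : ∀ t → ¬ (f ≐ 𝟎) → (∀ s → s ≤ k ⊓ (m ∸ k) → V̄ h s k f → t ≤ s) →
                ∀ s → s ≤ k ⊓ (suc m ∸ k) → V̄ ⊤ s k (Ψ f) → suc t ⊓ k ≤ s
    Ψ-degree≥ t f≢0 minimal s s≤ d with V̄⇒Degree≤ d | suc s ℕ.≤? k
    ... | _      | no  s≮k = ℕ.≤-trans (ℕ.m⊓n≤n (suc t) k) (s≤s⁻¹ (ℕ.≰⇒> s≮k))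
    Ψ-degree≥ t f≢0 minimal zero s≤ d | w , eq | yes 0<k = contradiction
      (λ K → trans (sym (zeroExtend-value f K)) (trans (agrees w eq (value K) (toFlat K))
        (constant-drop hyp 0<k (ℕ.m≤n⇒m≤1+n k≤m) w (vanishes w eq) (value K) (toFlat K)))) f≢0
    Ψ-degree≥ t f≢0 minimal (suc j) s≤ d | w , eq | yes j<k = ℕ.≤-trans (ℕ.m⊓n≤m (suc t) k)
      (s≤s (minimal j (ℕ.⊓-glb (ℕ.<⇒≤ (ℕ.<⇒≤ j<k)) j≤m∸k)
        (Degree≤⇒V̄ (let w′ , eq′ = degree-drop hyp j<k j+k≤m w (vanishes w eq) in
                    w′ , λ K fK → trans (agrees w eq K fK) (eq′ K fK)))))
      where
      j<m∸k : suc j ≤ suc (m ∸ k)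
      j<m∸k = ≡.subst (suc j ≤_) suc-m∸k (ℕ.≤-trans s≤ (ℕ.m⊓n≤n k _))
      j≤m∸k = s≤s⁻¹ j<m∸k
      j+k≤m : suc j +ℕ k ≤ suc m
      j+k≤m = s≤s (≡.subst (j +ℕ k ≤_) (ℕ.m∸n+n≡m k≤m) (ℕ.+-monoˡ-≤ k j≤m∸k))

    isDegree-Ψ : ∀ d → IsDegree m f d → IsDegree (suc m) (Ψ f) (min (d +1) k)
    isDegree-Ψ ⊥₋ f≐0 K = trans (Ψ-cong f≐0 K) (Ψ-𝟎 K)
    isDegree-Ψ [ t ]₋ (f≢0 , t≤ , d , minimal) =
        (λ Ψf≐0 → f≢0 (Ψ-injective (λ K → trans (Ψf≐0 K) (sym (Ψ-𝟎 K)))))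
      , ℕ.⊓-glb (ℕ.m⊓n≤n (suc t) k) (ℕ.≤-trans (ℕ.m⊓n≤m (suc t) k)
          (≡.subst (suc t ≤_) (≡.sym suc-m∸k) (s≤s (ℕ.≤-trans t≤ (ℕ.m⊓n≤n k _)))))
      , Ψ-degree≤ t d
      , Ψ-degree≥ t f≢0 minimal

    -- The zero function has zero weights in every rank `j`, so treating its degree as 0 in `max0`
    -- is harmless.
    degree≤-from : ∀ d → IsDegree m f d → max0 d ≤ j → j ≤ k → Degree≤ h j k (zeroExtend f)
    degree≤-from {j} ⊥₋ f≐0 _ _ = const 0# , λ K fK →
      trans (zeroExtend-flat f fK) (trans (f≐0 (fromFlat fK)) (sym (Σ-0 (flat? S K j) (λ _ _ → refl))))
    degree≤-from [ t ]₋ (_ , _ , d , _) t≤j j≤k = degree-mono t≤j j≤k (V̄⇒Degree≤ d)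

    -- Weight distributions are unique in this range, so it is enough to exhibit expansions. For f
    -- the range condition is j + k ≤ m, for Ψ f it is e + k ≤ m + 1, and these are equivalent.
    weights : ∀ d → IsDegree m f d → ∀ j → max0 d ≤ j → suc j ≤ k ⊓ (suc m ∸ k) →
              let e = suc j in
              ∃[ w ] ∃[ v ]
                IsWeightDistribution j f w
                × IsWeightDistribution e (Ψ f) v
                × ((E : Grassmannian S ⊤ e) →
                    ((E≤H : value E ⊆ h) →
                      v E ≈ 1# / fromℕ (⟦ k ∸ e +ℕ 1 ⟧ q)
                            * ∑ (λ (E′ : Grassmannian S (value E) j) → w (weaken E≤H E′)))
                    × (¬ (value E ⊆ h) →
                      ∃[ E∩H ] value E∩H ≡ value E ∩ h
                        × v E ≈ - (fromℕ (⟦ k ∸ e ⟧ q)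
                                   / (fromℕ (q ^ (k ∸ e)) * fromℕ (⟦ k ∸ e +ℕ 1 ⟧ q)))
                                * w E∩H))
    weights d deg j d≤j e≤ with degree≤-from d deg d≤j (ℕ.<⇒≤ (ℕ.≤-trans e≤ (ℕ.m⊓n≤m k _)))
    ... | ŵ , eq = w , v
                 , isWeightDistribution (sub (toFlat H)) (rank (toFlat H)) (ℕ.<⇒≤ j<k) (s≤s⁻¹ e+k≤n) f≐w
                 , isWeightDistribution ⊤-sub ⊤-rank j<k e+k≤n (Ψ-expansion j<k (zeroExtend w) f≈Tw)
                 , λ E → below-h E , off-h E
      where
      e = suc j
      w : ℝ^[ h , j ]
      w = ŵ ∘ value
      v : ℝ^[ ⊤ , e ]
      v = extension h k j (zeroExtend w) ∘ value
      j<k : suc j ≤ k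
      j<k = ℕ.≤-trans e≤ (ℕ.m⊓n≤m k _)
      e+k≤n : e +ℕ k ≤ suc m
      e+k≤n = ≡.subst (e +ℕ k ≤_) (ℕ.m∸n+n≡m (ℕ.m≤n⇒m≤1+n k≤m)) (ℕ.+-monoˡ-≤ k (ℕ.≤-trans e≤ (ℕ.m⊓n≤n k _)))
      f≐w : f ≐ expansion k w
      f≐w = Degree≤⇒expansion ŵ (λ K → trans (sym (zeroExtend-value f K)) (eq (value K) (toFlat K)))
      f≈Tw : ∀ K → Flat S h k K → zeroExtend f K ≈ T j (zeroExtend w) K
      f≈Tw K fK = trans (eq K fK) (sym (zeroExtend-restricted ŵ K (below fK)))
      -- With truncated subtraction k - j = k - e + 1 relies on e ≤ k.
      [k-j]≡ : fromℕ (⟦ k ∸ j ⟧ q) ≡ fromℕ (⟦ k ∸ e +ℕ 1 ⟧ q)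
      [k-j]≡ = ≡.cong (λ t → fromℕ (⟦ t ⟧ q)) (≡.sym (≡.trans (ℕ.+-comm _ 1) (≡.sym (ℕ.+-∸-assoc 1 j<k))))

      below-h : ∀ E (E⊆h : value E ⊆ h) → v E ≈ 1# / fromℕ (⟦ k ∸ e +ℕ 1 ⟧ q)
                                                * ∑ (λ (E′ : Grassmannian S (value E) j) → w (weaken E⊆h E′))
      below-h E E⊆h = begin
        v E
          ≈⟨ extension-⊆ (zeroExtend w) E⊆h ⟩
        fromℕ (⟦ k ∸ j ⟧ q) ⁻¹ * T j (zeroExtend w) (value E)
          ≈⟨ *-cong (trans (sym (*-identityˡ _)) (reflexive (≡.cong (1# /_) [k-j]≡)))
               (trans (zeroExtend-restricted ŵ (value E) E⊆h)
                 (sym (zeroExtend-restricted {value E} ŵ (value E) ⊆-refl))) ⟩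
        1# / fromℕ (⟦ k ∸ e +ℕ 1 ⟧ q) * T j (zeroExtend (λ E′ → w (weaken E⊆h E′))) (value E)
          ≈⟨ *-congˡ (∑-as-Σ {value E} {j} (λ E′ → w (weaken E⊆h E′))) ⟨
        1# / fromℕ (⟦ k ∸ e +ℕ 1 ⟧ q) * ∑ (λ E′ → w (weaken E⊆h E′)) ∎

      off-h : ∀ E → ¬ (value E ⊆ h) →
              ∃[ E∩H ] value E∩H ≡ value E ∩ h
                × v E ≈ - (fromℕ (⟦ k ∸ e ⟧ q) / (fromℕ (q ^ (k ∸ e)) * fromℕ (⟦ k ∸ e +ℕ 1 ⟧ q))) * w E∩H
      off-h E E⊈h = fromFlat fE∩h , ≡.refl , trans (extension-⊈ (zeroExtend w) E⊈h)
        (*-cong (reflexive (≡.cong (λ D → - (fromℕ (⟦ k ∸ e ⟧ q) / (fromℕ (q ^ (k ∸ e)) * D))) [k-j]≡))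
                (zeroExtend-flat w fE∩h))
        where fE∩h = meet-flat-suc hyp (toFlat E) E⊈h

theorem6p4 :
  (ℝ : RealNumbers) (S : Space) (n : ℕ) → 1 ≤ n → HasRank S ⊤ n →
  (H : Grassmannian S ⊤ (n ∸ 1)) (k : ℕ) → k ≤ n ∸ 1 →
  let open Functions ℝ S
      q = baseOrder S
      h = value H
  in
  IsInjectiveLinear (Ψ {h} {k})
  × ((g : ℝ^[ ⊤ , k ]) → Image (Ψ {h} {k}) g ⇔ (∀ K → Support g K → value K ⊆ h))
  × ((f : ℝ^[ h , k ]) (d : ℕ ₋) → IsDegree (n ∸ 1) f d →
      IsDegree n (Ψ f) (min (d +1) k)
      × ((e : ℕ) → max0 d +ℕ 1 ≤ e → e ≤ k ⊓ (n ∸ k) →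
          ∃[ w ] ∃[ v ]
            IsWeightDistribution (e ∸ 1) f w
            × IsWeightDistribution e (Ψ f) v
            × ((E : Grassmannian S ⊤ e) →
                ((E≤H : value E ⊆ h) →
                  v E ≈ 1# / fromℕ (⟦ k ∸ e +ℕ 1 ⟧ q)
                        * ∑ (λ (E′ : Grassmannian S (value E) (e ∸ 1)) → w (weaken E≤H E′)))
                × (¬ (value E ⊆ h) →
                  ∃[ E∩H ] value E∩H ≡ value E ∩ h
                    × v E ≈ - (fromℕ (⟦ k ∸ e ⟧ q)
                               / (fromℕ (q ^ (k ∸ e)) * fromℕ (⟦ k ∸ e +ℕ 1 ⟧ q)))
                            * w E∩H))))
theorem6p4 ℝ S (suc m) 1≤n ⊤-rank H k k≤m =
    Embedding.isInjectiveLinear ℝ S (value H) k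
  , Embedding.image⇔support ℝ S (value H) k
  -- The case e = 0 contradicts the lower bound on e; for e = j + 1 the truncated predecessors in
  -- the statement compute.
  , λ f d deg → isDegree-Ψ f d deg , λ where
      zero    d<e → contradiction (≡.subst (_≤ 0) (ℕ.+-comm (max0 d) 1) d<e) λ ()
      (suc j) d<e → weights f d deg j (s≤s⁻¹ (≡.subst (_≤ suc j) (ℕ.+-comm (max0 d) 1) d<e))
  where open Degrees ℝ S ⊤-rank H k k≤m
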